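{- Let $R$ be a fixed finite commutative ring of prime-power characteristic (i.e. $\mathrm{char}(R)=p^k$ for a prime $p$ and some $k\geq1$). Then each of the classes $\Sigma^{\text{qf}}_{\mathrm{FO}}(R)$, $\Sigma_{\mathrm{FO}}(R)$ and $\Sigma^{T}_{\mathrm{FO}}(R)$ is closed under first-order operations: it is closed under complementation, under conjunction (intersection), and under first-order (universal and existential) quantification.
   Context: All structures are finite. For a fixed finite commutative ring $R$, $\tau_{\text{les}}(R)$ has a binary symbol $A_r$ and unary symbol $b_r$ for each $r\in R$; a $\tau_{\text{les}}(R)$-structure encodes the system $(A,\mathbf b)$ over $R$ with $A(i,j)=r$ iff $(i,j)\in A_r$ and $\mathbf b(i)=r$ iff $i\in b_r$. $\mathrm{Solve}(R)$ is the class of $\tau_{\text{les}}(R)$-structures encoding systems solvable over $R$. A query on $\sigma$-structures with $j$ free variables is an isomorphism-closed class of pairs $(\mathcal A,\bar a)$, $\bar a\in A^j$; it is reducible to $\mathrm{Solve}(R)$ via an interpretation with parameters $\bar x$ if $(\mathcal A,\bar a)$ is in the query iff $\mathcal I(\bar a)(\mathcal A)\in\mathrm{Solve}(R)$. $\Sigma^{\text{qf}}_{\mathrm{FO}}(R)$, $\Sigma_{\mathrm{FO}}(R)$, $\Sigma^T_{\mathrm{FO}}(R)$ are the classes of queries reducible to $\mathrm{Solve}(R)$ by quantifier-free interpretations, first-order interpretations, and first-order Turing reductions (definability in first-order logic with the vectorised Lindström quantifiers for $\mathrm{Solve}(R)$), respectively. Closure under quantification means: if a query $q(\bar x,y)$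 is in the class, so are $\forall y\,q$ and $\exists y\,q$. -}

module Defs where

open import Data.Nat using (ℕ; zero; suc; _^_; _<_; _≤_)
open import Data.Nat.Primality using (Prime)
open import Data.Fin using (Fin; zero; suc)
open import Data.Fin.Properties using (+↔⊎)
open import Data.Bool using (Bool; T)
open import Data.Product using (Σ; ∃; ∃₂; _×_; _,_; proj₁; proj₂)
open import Data.Sum using (_⊎_; inj₁; inj₂; [_,_])
open import Data.Empty using (⊥)
open import Data.Unit using (⊤)
open import Data.Maybe using (Maybe; maybe′)
open import Data.Vec using (Vec; []; _∷_; lookup; map)
open import Relation.Nullary using (¬_)
open import Relation.Binary.PropositionalEquality using (_≡_; _≢_)
open import Function.Bundles using (_⇔_; _↔_; Inverse)
open import Function.Properties.Inverse using (↔-sym)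
open import Algebra.Structures using (IsCommutativeRing)

record FinCommRing : Set where
  field
    size : ℕ
    _+ᴿ_ _*ᴿ_ : Fin size → Fin size → Fin size
    -ᴿ_ : Fin size → Fin size
    0ᴿ 1ᴿ : Fin size
    isCommRing : IsCommutativeRing _≡_ _+ᴿ_ _*ᴿ_ -ᴿ_ 0ᴿ 1ᴿ

  Carrier : Set
  Carrier = Fin size

  natᴿ : ℕ → Carrier
  natᴿ zero = 0ᴿ
  natᴿ (suc n) = 1ᴿ +ᴿ natᴿ n

  IsCharacteristic : ℕ → Set
  IsCharacteristic c =
    0 < c × natᴿ c ≡ 0ᴿ × (∀ m → 0 < m → m < c → natᴿ m ≢ 0ᴿ)

  sumᴿ : (m : ℕ) → (Fin m → Carrier) → Carrier
  sumᴿ zero f = 0ᴿ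
  sumᴿ (suc m) f = f zero +ᴿ sumᴿ m (λ i → f (suc i))

open FinCommRing public

PrimePowerChar : FinCommRing → Set
PrimePowerChar R = Σ ℕ λ p → Σ ℕ λ k → Prime p × 1 ≤ k × IsCharacteristic R (p ^ k)

record Signature : Set₁ where
  field
    Sym : Set
    arity : Sym → ℕ
    finite : Σ ℕ λ k → Sym ↔ Fin k

open Signature public

Struct : Signature → ℕ → Set
Struct σ n = (s : Sym σ) → Vec (Fin n) (arity σ s) → Bool

-- structures with Set-valued relations (used for interpreted structures)
SStruct : Signature → ℕ → Set₁
SStruct σ n = (s : Sym σ) → Vec (Fin n) (arity σ s) → Set

module _ (R : FinCommRing) where

  arityLes : Carrier R ⊎ Carrier R → ℕ
  arityLes (inj₁ r) = 2
  arityLes (inj₂ r) = 1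

  τles : Signature
  τles = record { Sym = Carrier R ⊎ Carrier R ; arity = arityLes
                ; finite = size R Data.Nat.+ size R , ↔-sym +↔⊎ }

  Encodes : ∀ {m} → SStruct τles m → (Fin m → Fin m → Carrier R) → (Fin m → Carrier R) → Set
  Encodes 𝔅 A b =
    (∀ i j r → 𝔅 (inj₁ r) (i ∷ j ∷ []) ⇔ (A i j ≡ r)) ×
    (∀ i r → 𝔅 (inj₂ r) (i ∷ []) ⇔ (b i ≡ r))

  Solvable : ∀ m → (Fin m → Fin m → Carrier R) → (Fin m → Carrier R) → Set
  Solvable m A b = Σ (Fin m → Carrier R) λ x →
    ∀ i → sumᴿ R m (λ j → _*ᴿ_ R (A i j) (x j)) ≡ b i

  InSolve : ∀ {m} → SStruct τles m → Set
  InSolve {m} 𝔅 = Σ (Fin m → Fin m → Carrier R) λ A → Σ (Fin m → Carrier R) λ b →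
    Encodes 𝔅 A b × Solvable m A b

  -- Semantic data of a d-dimensional interpretation of τ_les(R) in a
  -- structure with universe Fin n: domain δ, equivalence ε, relations φ_s.

  record IData (n d : ℕ) : Set₁ where
    field
      Dom : Vec (Fin n) d → Set
      Eqv : Vec (Fin n) d → Vec (Fin n) d → Set
      Rel : (s : Sym τles) → Vec (Vec (Fin n) d) (arity τles s) → Set

  module _ {n d : ℕ} (D : IData n d) where
    open IData D

    WellDef : Set
    WellDef =
      (∀ y → Dom y → Eqv y y) ×
      (∀ y z → Dom y → Dom z → Eqv y z → Eqv z y) ×
      (∀ y z w → Dom y → Dom z → Dom w → Eqv y z → Eqv z w → Eqv y w) ×
      (∀ s (ys zs : Vec (Vec (Fin n) d) (arity τles s)) →
         (∀ i → Dom (lookup ys i)) → (∀ i → Dom (lookup zs i)) →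
         (∀ i → Eqv (lookup ys i) (lookup zs i)) → Rel s ys → Rel s zs)

    record Quotienting (m : ℕ) : Set where
      field
        cls : (y : Vec (Fin n) d) → Dom y → Fin m
        cls-surj : ∀ u → Σ (Vec (Fin n) d) λ y → Σ (Dom y) λ p → cls y p ≡ u
        cls-ker : ∀ y z (p : Dom y) (q : Dom z) → (cls y p ≡ cls z q) ⇔ Eqv y z

    quotStruct : ∀ {m} → Quotienting m → SStruct τles m
    quotStruct Q s us =
      Σ (Vec (Vec (Fin n) d) (arity τles s)) λ ys →
      Σ (∀ i → Dom (lookup ys i)) λ ps →
      (∀ i → Quotienting.cls Q (lookup ys i) (ps i) ≡ lookup us i) × Rel s ys

    IInSolve : Set
    IInSolve = Σ ℕ λ m → Σ (Quotienting m) λ Q → InSolve (quotStruct Q)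

  pick : ∀ {A : Set} {k d} → Vec (Vec A d) k → Fin k × Fin d → A
  pick ys p = lookup (lookup ys (proj₁ p)) (proj₂ p)

  -- First-order logic over σ extended with vectorised Lindström
  -- quantifiers for Solve(R).  Variables range over an arbitrary type V.

  data Formula (σ : Signature) : Set → Set₁ where
    rel  : ∀ {V} (s : Sym σ) → Vec V (arity σ s) → Formula σ V
    eq   : ∀ {V} → V → V → Formula σ V
    tt   : ∀ {V} → Formula σ V
    neg  : ∀ {V} → Formula σ V → Formula σ V
    and  : ∀ {V} → Formula σ V → Formula σ V → Formula σ V
    or   : ∀ {V} → Formula σ V → Formula σ V → Formula σ V
    ex   : ∀ {V} → Formula σ (Maybe V) → Formula σ V
    all  : ∀ {V} → Formula σ (Maybe V) → Formula σ V
    -- Q_Solve(R) ȳ (δ, ε, (φ_s)_s): binds d-dimensional tuples,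
    -- the variables V are parameters
    solveQ : ∀ {V} (d : ℕ) →
      Formula σ (V ⊎ Fin d) →
      Formula σ (V ⊎ (Fin 2 × Fin d)) →
      ((s : Sym τles) → Formula σ (V ⊎ (Fin (arity τles s) × Fin d))) →
      Formula σ V

  Sat : ∀ {σ V n} → Struct σ n → Formula σ V → (V → Fin n) → Set
  Sat 𝒜 (rel s xs) ρ = T (𝒜 s (map ρ xs))
  Sat 𝒜 (eq x y) ρ = ρ x ≡ ρ y
  Sat 𝒜 tt ρ = ⊤
  Sat 𝒜 (neg φ) ρ = ¬ Sat 𝒜 φ ρ
  Sat 𝒜 (and φ ψ) ρ = Sat 𝒜 φ ρ × Sat 𝒜 ψ ρ
  Sat 𝒜 (or φ ψ) ρ = Sat 𝒜 φ ρ ⊎ Sat 𝒜 ψ ρ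
  Sat {n = n} 𝒜 (ex φ) ρ = Σ (Fin n) λ a → Sat 𝒜 φ (maybe′ ρ a)
  Sat {n = n} 𝒜 (all φ) ρ = (a : Fin n) → Sat 𝒜 φ (maybe′ ρ a)
  Sat 𝒜 (solveQ d δ ε φ) ρ = WellDef D × IInSolve D
    where
    D : IData _ d
    D = record
      { Dom = λ y → Sat 𝒜 δ [ ρ , lookup y ]
      ; Eqv = λ y z → Sat 𝒜 ε [ ρ , pick (y ∷ z ∷ []) ]
      ; Rel = λ s ys → Sat 𝒜 (φ s) [ ρ , pick ys ]
      }

  IsQF : ∀ {σ V} → Formula σ V → Set
  IsQF (rel s xs) = ⊤
  IsQF (eq x y) = ⊤
  IsQF tt = ⊤
  IsQF (neg φ) = IsQF φ
  IsQF (and φ ψ) = IsQF φ × IsQF ψ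
  IsQF (or φ ψ) = IsQF φ × IsQF ψ
  IsQF (ex φ) = ⊥
  IsQF (all φ) = ⊥
  IsQF (solveQ d δ ε φ) = ⊥

  IsFO : ∀ {σ V} → Formula σ V → Set
  IsFO (rel s xs) = ⊤
  IsFO (eq x y) = ⊤
  IsFO tt = ⊤
  IsFO (neg φ) = IsFO φ
  IsFO (and φ ψ) = IsFO φ × IsFO ψ
  IsFO (or φ ψ) = IsFO φ × IsFO ψ
  IsFO (ex φ) = IsFO φ
  IsFO (all φ) = IsFO φ
  IsFO (solveQ d δ ε φ) = ⊥

  record Interp (σ : Signature) (j : ℕ) : Set₁ where
    field
      dim : ℕ
      δ : Formula σ (Fin j ⊎ Fin dim)
      ε : Formula σ (Fin j ⊎ (Fin 2 × Fin dim))
      φ : (s : Sym τles) → Formula σ (Fin j ⊎ (Fin (arity τles s) × Fin dim))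

  ⟦_⟧ : ∀ {σ j n} (I : Interp σ j) → Struct σ n → Vec (Fin n) j → IData n (Interp.dim I)
  ⟦ I ⟧ 𝒜 a = record
    { Dom = λ y → Sat 𝒜 δ [ lookup a , lookup y ]
    ; Eqv = λ y z → Sat 𝒜 ε [ lookup a , pick (y ∷ z ∷ []) ]
    ; Rel = λ s ys → Sat 𝒜 (φ s) [ lookup a , pick ys ]
    }
    where open Interp I

  AllFormulas : ∀ {σ j} → (∀ {V} → Formula σ V → Set) → Interp σ j → Set
  AllFormulas P I = P δ × P ε × (∀ s → P (φ s))
    where open Interp I

-- Queries (on nonempty finite structures, universe Fin (suc n))

Query : Signature → ℕ → Set₁
Query σ j = (n : ℕ) → Struct σ (suc n) → Vec (Fin (suc n)) j → Set

Iso : ∀ {σ n n'} → Struct σ n → Struct σ n' → (Fin n ↔ Fin n') → Set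
Iso {σ} 𝒜 𝔅 f = ∀ (s : Sym σ) (t : Vec _ (arity σ s)) → 𝒜 s t ≡ 𝔅 s (map (Inverse.to f) t)

IsoClosed : ∀ {σ j} → Query σ j → Set
IsoClosed {σ} q = ∀ n n' (𝒜 : Struct σ (suc n)) (𝔅 : Struct σ (suc n')) (f : Fin (suc n) ↔ Fin (suc n')) →
  Iso {σ} 𝒜 𝔅 f → ∀ a → q n 𝒜 a → q n' 𝔅 (map (Inverse.to f) a)

qNot : ∀ {σ j} → Query σ j → Query σ j
qNot q n 𝒜 a = ¬ q n 𝒜 a

qAnd : ∀ {σ j} → Query σ j → Query σ j → Query σ j
qAnd q₁ q₂ n 𝒜 a = q₁ n 𝒜 a × q₂ n 𝒜 a

qAll : ∀ {σ j} → Query σ (suc j) → Query σ j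
qAll q n 𝒜 a = (b : Fin (suc n)) → q n 𝒜 (b ∷ a)

qEx : ∀ {σ j} → Query σ (suc j) → Query σ j
qEx q n 𝒜 a = Σ (Fin (suc n)) λ b → q n 𝒜 (b ∷ a)

data RedKind : Set where
  qfRed foRed turingRed : RedKind

module _ (R : FinCommRing) where

  ReducesVia : ∀ {σ j} → Interp R σ j → Query σ j → Set
  ReducesVia I q =
    (∀ n 𝒜 a → WellDef R (⟦_⟧ R {n = suc n} I 𝒜 a)) ×
    (∀ n 𝒜 a → q n 𝒜 a ⇔ IInSolve R (⟦_⟧ R {n = suc n} I 𝒜 a))

  Reducible : RedKind → ∀ {σ j} → Query σ j → Set₁
  Reducible qfRed {σ} {j} q = Σ (Interp R σ j) λ I → AllFormulas R (λ φ → IsQF R φ) I × ReducesVia I q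
  Reducible foRed {σ} {j} q = Σ (Interp R σ j) λ I → AllFormulas R (λ φ → IsFO R φ) I × ReducesVia I q
  Reducible turingRed {σ} {j} q = Σ (Formula R σ (Fin j)) λ ψ →
    ∀ n 𝒜 a → q n 𝒜 a ⇔ Sat R {σ} {Fin j} {suc n} 𝒜 ψ (lookup a)

  InClass : RedKind → (σ : Signature) (j : ℕ) → Query σ j → Set₁
  InClass k σ j q = IsoClosed {σ} {j} q × Reducible k {σ} {j} q

{-# OPTIONS --safe #-}
-- Complementation rests on duality.  A system M x = v over R is unsolvable iff v is separated from the column span
-- of M by additive functionals R → ℤ/pᵏ.  As ℤ/pᵏ is the prime subring of R, one may allow values in R, and then the
-- functionals are the solutions of another linear system over R, with entries quantifier-free definable from M, v.
-- That one of the two systems is solvable is the Fredholm alternative over ℤ/pᵏ, proved by Gaussian elimination with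
-- pivots of least p-adic valuation; that not both are is immediate from pᵏ⁻¹ ≠ 0 in R.
--
-- Conjunctions and universal quantifiers are block-diagonal systems, and ∃ = ¬ ∀ ¬.  Blocks are distinguished by
-- equality types of tuples.  This fails in one-element universes, where a query is instead given by a sentence that
-- enters the final system through extra rows, which are always solvable as soon as there is a second element.
--
-- Solvability is expressed as v ∈ span of the columns, which is insensitive to repeated rows and columns; hence all
-- interpretations built here have total domain and trivial equality.
module Submission where

open import Algebra.Bundles using (CommutativeRing; RawRing)
import Algebra.Morphism.RingMonomorphism as RingMonomorphism
open import Algebra.Morphism.Structures using (IsRingMonomorphism)
import Algebra.Properties.AbelianGroup
import Algebra.Properties.Ring
import Algebra.Solver.Ring.NaturalCoefficients.Default
open import Data.Bool using (Bool; true; false; if_then_else_; T; not)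
import Data.Bool.Properties as Bool
open import Data.Fin using (Fin; zero; suc; punchIn; punchOut; _↑ˡ_; _↑ʳ_)
open import Data.Fin.Properties as Fin using (punchIn-punchOut)
open import Data.List as List
  using (List; []; _∷_; cartesianProduct; allFin; deduplicate; cartesianProductWith)
open import Data.List.Extrema.Nat using (f[argmin]≤f[xs])
open import Data.List.Membership.Propositional using (_∈_; find)
open import Data.List.Membership.Propositional.Properties
  using (∈-cartesianProduct⁺; ∈-allFin; ∈-deduplicate⁺; ∈-++⁺ˡ; ∈-++⁺ʳ; ∈-map⁺; ∈-cartesianProductWith⁺)
open import Data.List.Relation.Unary.All as All using (All; []; _∷_)
open import Data.List.Relation.Unary.All.Properties using (¬All⇒Any¬)
open import Data.List.Relation.Unary.Any using (here; there; index)
open import Data.List.Relation.Unary.Any.Properties using (lookup-index)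
open import Data.List.Relation.Unary.Unique.DecPropositional.Properties using (deduplicate-!)
open import Data.List.Relation.Unary.Unique.Propositional using (Unique; []; _∷_)
open import Data.List.Relation.Unary.Unique.Propositional.Properties using (allFin⁺)
open import Data.Maybe as Maybe using (Maybe; just; nothing; maybe′)
open import Data.Nat as ℕ using (ℕ; zero; suc; _≤_; _<_; _∸_; _^_; z≤n; s≤s)
open import Data.Nat.Coprimality using (coprime-divisor)
open import Data.Nat.Divisibility using (_∣_; _∣?_; divides; quotient; m∣n⇒n≡quotient*m; ∣1⇒≡1; *-cancelˡ-∣)
open import Data.Nat.GCD using (GCD; module Bézout)
open import Data.Nat.Primality using (Prime; prime⇒irreducible; prime⇒nonZero; prime⇒nonTrivial)
import Data.Nat.Properties as ℕ
open import Data.Product as Prod using (Σ; ∃; _×_; _,_; proj₁; proj₂; map₂; <_,_>)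
open import Data.Product.Properties using () renaming (≡-dec to ×-≡-dec)
open import Data.Sum as Sum using (_⊎_; inj₁; inj₂; [_,_]; [_,_]′)
open import Data.Unit using (⊤; tt)
open import Data.Vec as Vec using (Vec; []; _∷_; lookup; replicate; tabulate)
import Data.Vec.Properties as Vec
open import Function using (_∘_; id)
open import Function.Bundles using (_⇔_; mk⇔; Equivalence; _↔_; Inverse)
open import Function.Properties.Equivalence using () renaming (refl to ⇔-refl; sym to ⇔-sym; trans to ⇔-trans)
open import Function.Properties.Inverse using (↔-sym)
open import Level using (0ℓ)
open import Relation.Binary.Definitions using (DecidableEquality)
open import Relation.Binary.PropositionalEquality as ≡ using (_≡_; _≢_; module ≡-Reasoning; _≗_)
import Relation.Binary.Reasoning.Setoid
open import Relation.Nullary using (Dec; yes; no; does; contradiction; ¬_)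
open import Relation.Nullary.Decidable
  using (dec-false; dec-true; T?; ¬?; _×-dec_; _⊎-dec_; decidable-stable) renaming (map to dec-map)

-- Linear algebra over a commutative ring

-- A submodule of a free R-module need not be cut out by R-linear functionals, because R need not be
-- injective over itself. ℤ/pᵏ is, and this is why the functionals are merely additive. An additive
-- functional may vanish on a column without vanishing on its multiples, so every multiple r Mᵢⱼ
-- gets its own condition, and a coordinate of a functional is an unknown function on R instead of a
-- single scalar.
--
-- The elimination cannot be run on M, whose entries may lie outside the prime subring. It is run on
-- the dual, whose coefficients come from natural numbers. If the dual fails, some combination of
-- its equations has zero left-hand side and right-hand side pᵏ⁻¹; replacing each unknown yᵢ(t) by t
-- turns this combination into an expression of v through the columns of M. The constant pᵏ⁻¹
-- generates the least nonzero ideal of ℤ/pᵏ, so every nonzero value of a functional can be scaled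
-- to it.
--
-- A second obstacle is that an interpreted structure may encode no system at all, its relations not
-- being functional. The complement of the query must then hold, so before dualising each
-- interpretation is replaced by a system that is always well defined and has a contradictory row in
-- the malformed case.

module Identities (K : CommutativeRing 0ℓ 0ℓ) where
  open CommutativeRing K
  open Algebra.Properties.AbelianGroup +-abelianGroup using (\\-leftDividesˡ; \\-leftDividesʳ)
  open Algebra.Properties.Ring ring using (-‿distribˡ-*)
  open Algebra.Solver.Ring.NaturalCoefficients.Default commutativeSemiring

  axpy-assoc : ∀ c d m u w → c * (d * m + u) + w ≈ c * d * m + (c * u + w)
  axpy-assoc = solve 5 (λ c d m u w → c :* (d :* m :+ u) :+ w := c :* d :* m :+ (c :* u :+ w)) refl

  axpy-swap : ∀ d c u w x y → d * (c * u + w) + (c * x + y) ≈ c * (d * u + x) + (d * w + y)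
  axpy-swap = solve 6 (λ d c u w x y →
    d :* (c :* u :+ w) :+ (c :* x :+ y) := c :* (d :* u :+ x) :+ (d :* w :+ y)) refl

  *-assoc-middle : ∀ q p c a → q * (p * (c * a)) ≈ q * p * c * a
  *-assoc-middle = solve 4 (λ q p c a → q :* (p :* (c :* a)) := q :* p :* c :* a) refl

  *-shuffle : ∀ p c q r → p * c * (q * r) ≈ c * q * (p * r)
  *-shuffle = solve 4 (λ p c q r → p :* c :* (q :* r) := c :* q :* (p :* r)) refl

  neg-*-swap : ∀ x y → - x * y ≈ - y * x
  neg-*-swap x y = trans (sym (-‿distribˡ-* x y)) (trans (-‿cong (*-comm x y)) (-‿distribˡ-* y x))

  cancel-multiple : ∀ x c a w → x * (c * a) + (- (x * a) * c + w) ≈ w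
  cancel-multiple x c a w = trans
    (+-congˡ (+-congʳ (trans (sym (-‿distribˡ-* (x * a) c)) (-‿cong (xac x c a)))))
    (\\-leftDividesˡ _ w)
    where
    xac : ∀ x c a → x * a * c ≈ x * (c * a)
    xac = solve 3 (λ x c a → x :* a :* c := x :* (c :* a)) refl

  cancel-term : ∀ x m y → - x * m + (x * m + y) ≈ y
  cancel-term x m y = trans (+-congʳ (sym (-‿distribˡ-* x m))) (\\-leftDividesʳ _ y)

  cancel-product : ∀ a c → - a * c + c * a ≈ 0#
  cancel-product a c = trans (+-cong (sym (-‿distribˡ-* a c)) (*-comm c a)) (-‿inverseˡ (a * c))

module Span (K : CommutativeRing 0ℓ 0ℓ) where
  open CommutativeRing K
  open Identities K
  open Relation.Binary.Reasoning.Setoid setoid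

  private
    zero-comb : ∀ c x y → x ≈ 0# → y ≈ 0# → c * x + y ≈ 0#
    zero-comb c x y x≈0 y≈0 = begin
      c * x + y   ≈⟨ +-cong (*-congˡ x≈0) y≈0 ⟩
      c * 0# + 0# ≈⟨ +-identityʳ _ ⟩
      c * 0#      ≈⟨ zeroʳ c ⟩
      0#          ∎

  -- Generators are added one at a time, with repetition, so neither index type has to be finite or
  -- to have decidable equality, and linear maps act by induction. The pointwise equations in the
  -- constructors make up for the absence of function extensionality.
  data InSpan {I J : Set} (M : I → J → Carrier) : (I → Carrier) → Set where
    nil  : ∀ {v} → (∀ i → v i ≈ 0#) → InSpan M v
    cons : ∀ {v w} j c → InSpan M w → (∀ i → v i ≈ c * M i j + w i) → InSpan M v

  module _ {I J : Set} {M : I → J → Carrier} where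

    span-resp : ∀ {v w} → (∀ i → v i ≈ w i) → InSpan M v → InSpan M w
    span-resp v≈w (nil v≈0)      = nil (λ i → trans (sym (v≈w i)) (v≈0 i))
    span-resp v≈w (cons j c s e) = cons j c s (λ i → trans (sym (v≈w i)) (e i))

    span-gen : ∀ j → InSpan M (λ i → M i j)
    span-gen j = cons j 1# (nil {v = λ _ → 0#} (λ _ → refl)) (λ i → sym (trans (+-identityʳ _) (*-identityˡ _)))

    span-axpy : ∀ c {v w} → InSpan M v → InSpan M w → InSpan M (λ i → c * v i + w i)
    span-axpy c {v} {w} (nil v≈0) t = span-resp (λ i → sym (lem i)) t
      where
      lem : ∀ i → c * v i + w i ≈ w i
      lem i = begin
        c * v i + w i ≈⟨ +-congʳ (*-congˡ (v≈0 i)) ⟩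
        c * 0# + w i  ≈⟨ +-congʳ (zeroʳ c) ⟩
        0# + w i      ≈⟨ +-identityˡ _ ⟩
        w i           ∎
    span-axpy c {v} {w} (cons {w = u} j d s e) t = cons j (c * d) (span-axpy c s t) λ i → begin
      c * v i + w i                   ≈⟨ +-congʳ (*-congˡ (e i)) ⟩
      c * (d * M i j + u i) + w i     ≈⟨ axpy-assoc c d (M i j) (u i) (w i) ⟩
      c * d * M i j + (c * u i + w i) ∎

    span-scale : ∀ c {v} → InSpan M v → InSpan M (λ i → c * v i)
    span-scale c s = span-resp (λ i → +-identityʳ _) (span-axpy c s (nil {v = λ _ → 0#} (λ _ → refl)))

    span-zero-row : ∀ {v} i → (∀ j → M i j ≈ 0#) → InSpan M v → v i ≈ 0#
    span-zero-row i z (nil e)        = e i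
    span-zero-row i z (cons j c s e) = trans (e i) (zero-comb c _ _ (z j) (span-zero-row i z s))

  -- Linearity of `Λ` is required in exactly the two shapes that `nil` and `cons` present.
  -- Reindexing of rows and extension by zero are the instances used.
  span-linear : ∀ {I I′ J J′ : Set} {M : I → J → Carrier} {M′ : I′ → J′ → Carrier}
    (Λ : (I → Carrier) → (I′ → Carrier)) →
    (∀ {v} → (∀ i → v i ≈ 0#) → ∀ i → Λ v i ≈ 0#) →
    (∀ {c u v w} → (∀ i → v i ≈ c * u i + w i) → ∀ i → Λ v i ≈ c * Λ u i + Λ w i) →
    (∀ j → InSpan M′ (Λ (λ i → M i j))) →
    ∀ {v} → InSpan M v → InSpan M′ (Λ v)
  span-linear Λ Λ-zero Λ-axpy gen (nil v≈0)      = nil (Λ-zero v≈0)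
  span-linear Λ Λ-zero Λ-axpy gen (cons j c s e) =
    span-resp (λ i → sym (Λ-axpy e i)) (span-axpy c (gen j) (span-linear Λ Λ-zero Λ-axpy gen s))

  span-pull : ∀ {I I′ J J′ : Set} {M : I → J → Carrier} {M′ : I′ → J′ → Carrier} (f : I′ → I) →
    (∀ j → InSpan M′ (λ i → M (f i) j)) →
    ∀ {v} → InSpan M v → InSpan M′ (v ∘ f)
  span-pull f = span-linear (_∘ f) (λ z i → z (f i)) (λ e i → e (f i))

  eval : ∀ {I : Set} → List (I × Carrier) → (I → Carrier) → Carrier
  eval []            v = 0#
  eval ((i , c) ∷ y) v = c * v i + eval y v

  module _ {I : Set} where

    eval-zero : ∀ (y : List (I × Carrier)) {v} → (∀ i → v i ≈ 0#) → eval y v ≈ 0#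
    eval-zero []            z = refl
    eval-zero ((i , c) ∷ y) z = zero-comb c _ _ (z i) (eval-zero y z)

    eval-axpy : ∀ (y : List (I × Carrier)) {c u v w} → (∀ i → v i ≈ c * u i + w i) →
      eval y v ≈ c * eval y u + eval y w
    eval-axpy [] {c} e = sym (zero-comb c 0# 0# refl refl)
    eval-axpy ((i , d) ∷ y) {c} {u} {v} {w} e = begin
      d * v i + eval y v                               ≈⟨ +-cong (*-congˡ (e i)) (eval-axpy y e) ⟩
      d * (c * u i + w i) + (c * eval y u + eval y w)  ≈⟨ axpy-swap d c (u i) (w i) _ _ ⟩
      c * (d * u i + eval y u) + (d * w i + eval y w)  ∎

    eval-cong : ∀ (y : List (I × Carrier)) {v w} → (∀ i → v i ≈ w i) → eval y v ≈ eval y w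
    eval-cong []            e = refl
    eval-cong ((i , c) ∷ y) e = +-cong (*-congˡ (e i)) (eval-cong y e)

  eval-swap : ∀ {A B : Set} (y : List (A × Carrier)) (z : List (B × Carrier)) (F : A → B → Carrier) →
    eval y (λ a → eval z (F a)) ≈ eval z (λ b → eval y (λ a → F a b))
  eval-swap []            z F = sym (eval-zero z (λ _ → refl))
  eval-swap ((a , c) ∷ y) z F = trans (+-congˡ (eval-swap y z F)) (sym (eval-axpy z (λ _ → refl)))

  eval-absent : ∀ {A : Set} (g f : A → Carrier) (P : A → Bool) as → All (λ a → P a ≡ false) as →
    eval (List.map (λ a → a , g a) as) (λ a → if P a then f a else 0#) ≈ 0#
  eval-absent g f P []       []        = refl
  eval-absent g f P (a ∷ as) (Pa ∷ Ps) rewrite Pa = zero-comb (g a) _ _ refl (eval-absent g f P as Ps)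

  -- A Kronecker delta selects one term; uniqueness of the list ensures that the term is counted
  -- once.
  eval-indicator : ∀ {A : Set} (_≟_ : DecidableEquality A) (g f : A → Carrier) {as a₀} →
    Unique as → a₀ ∈ as →
    eval (List.map (λ a → a , g a) as) (λ a → if does (a ≟ a₀) then f a else 0#) ≈ g a₀ * f a₀
  eval-indicator _≟_ g f {a ∷ as} (a∉as ∷ _) (here ≡.refl) with a ≟ a
  ... | yes _   = trans (+-congˡ (eval-absent g f _ as (All.map (λ a≢b → dec-false (_ ≟ a) (≡.≢-sym a≢b)) a∉as)))
                        (+-identityʳ _)
  ... | no  a≢a = contradiction ≡.refl a≢a
  eval-indicator _≟_ g f {a ∷ as} {a₀} (a∉as ∷ u) (there a₀∈as)
    rewrite dec-false (a ≟ a₀) (All.lookup a∉as a₀∈as) =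
    trans (+-cong (zeroʳ (g a)) (eval-indicator _≟_ g f u a₀∈as)) (+-identityˡ _)

  span-coefficients : ∀ {I J : Set} {M : I → J → Carrier} {v} → InSpan M v →
    ∃ λ y → ∀ i → v i ≈ eval y (M i)
  span-coefficients (nil v≈0)      = [] , v≈0
  span-coefficients (cons j c s e) = let y , v≈y = span-coefficients s in
    (j , c) ∷ y , λ i → trans (e i) (+-congˡ (v≈y i))

  span-combine : ∀ {B I J : Set} {M : I → J → Carrier} (y : List (B × Carrier)) {w : B → I → Carrier} →
    (∀ b → InSpan M (w b)) → InSpan M (λ i → eval y (λ b → w b i))
  span-combine []            s = nil (λ _ → refl)
  span-combine ((b , c) ∷ y) s = span-axpy c (s b) (span-combine y s)

  -- For nonzero `s` this is a witness of unsolvability: a combination of the equations whose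
  -- left-hand side is zero and whose right-hand side is `s`.
  Certificate : ∀ {I J : Set} → Carrier → (I → J → Carrier) → (I → Carrier) → Set
  Certificate {I} s M v =
    Σ (List (I × Carrier)) λ y → (∀ j → eval y (λ i → M i j) ≈ 0#) × eval y v ≈ s

-- P i plays the role of π ^ i for a uniformiser π with π ^ suc k = 0: every element is associated
-- to some P i.
record Uniformised (K : CommutativeRing 0ℓ 0ℓ) (k : ℕ) : Set where
  open CommutativeRing K
  field
    P     : ℕ → Carrier
    P-+   : ∀ i j → P (i ℕ.+ j) ≈ P i * P j
    P-top : P (suc k) ≈ 0#
    val   : ∀ a → Σ ℕ λ i → i ≤ suc k × (∃ λ q → a ≈ q * P i) × (∃ λ c → P i ≈ c * a)

-- The Fredholm alternative for uniformised rings

module Fredholm {K : CommutativeRing 0ℓ 0ℓ} {k : ℕ} (U : Uniformised K k) where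
  open CommutativeRing K hiding (zero)
  open Uniformised U
  open Identities K
  open Span K
  open Relation.Binary.Reasoning.Setoid setoid

  private
    ν : Carrier → ℕ
    ν a = proj₁ (val a)

  P-vanish : ∀ {i} → suc k ≤ i → P i ≈ 0#
  P-vanish {i} k<i = begin
    P i                              ≡⟨ ≡.cong P (ℕ.m+[n∸m]≡n k<i) ⟨
    P (suc k ℕ.+ (i ∸ suc k))        ≈⟨ P-+ (suc k) (i ∸ suc k) ⟩
    P (suc k) * P (i ∸ suc k)        ≈⟨ *-congʳ P-top ⟩
    0# * P (i ∸ suc k)               ≈⟨ zeroˡ _ ⟩
    0#                               ∎

  ν-divides : ∀ a b → ν a ≤ ν b → ∃ λ q → b ≈ q * a
  ν-divides a b a≤b with val a | val b
  ... | i , _ , _ , c , Pi≈ca | j , _ , (q , b≈qPj) , _ = q * P (j ∸ i) * c , (begin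
    b                        ≈⟨ b≈qPj ⟩
    q * P j                  ≡⟨ ≡.cong (λ l → q * P l) (ℕ.m∸n+n≡m a≤b) ⟨
    q * P (j ∸ i ℕ.+ i)      ≈⟨ *-congˡ (P-+ (j ∸ i) i) ⟩
    q * (P (j ∸ i) * P i)    ≈⟨ *-congˡ (*-congˡ Pi≈ca) ⟩
    q * (P (j ∸ i) * (c * a)) ≈⟨ *-assoc-middle q (P (j ∸ i)) c a ⟩
    q * P (j ∸ i) * c * a    ∎)

  ν-top : ∀ a → suc k ≤ ν a → a ≈ 0#
  ν-top a k<a with val a
  ... | i , _ , (q , a≈qPi) , _ = begin
    a        ≈⟨ a≈qPi ⟩
    q * P i  ≈⟨ *-congˡ (P-vanish k<a) ⟩
    q * 0#   ≈⟨ zeroʳ q ⟩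
    0#       ∎

  -- Some multiple of `d` is P l, where l is its valuation. The further factor P (k ∸ l) moves it to
  -- P k, the last power not forced to be zero, and moves everything of larger valuation to zero.
  separate : ∀ d → ν d < suc k → ∃ λ c → c * d ≈ P k × (∀ a → ν d < ν a → c * a ≈ 0#)
  separate d d<k with val d
  ... | l , _ , _ , c , Pl≈cd = P (k ∸ l) * c , hit , kill
    where
    hit : P (k ∸ l) * c * d ≈ P k
    hit = begin
      P (k ∸ l) * c * d    ≈⟨ *-assoc _ _ _ ⟩
      P (k ∸ l) * (c * d)  ≈⟨ *-congˡ Pl≈cd ⟨
      P (k ∸ l) * P l      ≈⟨ P-+ (k ∸ l) l ⟨
      P (k ∸ l ℕ.+ l)      ≡⟨ ≡.cong P (ℕ.m∸n+n≡m (ℕ.≤-pred d<k)) ⟩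
      P k                  ∎
    kill : ∀ a → l < ν a → P (k ∸ l) * c * a ≈ 0#
    kill a l<a with val a
    ... | i , _ , (q , a≈qPi) , _ = begin
      P (k ∸ l) * c * a          ≈⟨ *-congˡ a≈qPi ⟩
      P (k ∸ l) * c * (q * P i)  ≈⟨ *-shuffle (P (k ∸ l)) c q (P i) ⟩
      c * q * (P (k ∸ l) * P i)  ≈⟨ *-congˡ (P-+ (k ∸ l) i) ⟨
      c * q * P (k ∸ l ℕ.+ i)    ≈⟨ *-congˡ (P-vanish bound) ⟩
      c * q * 0#                 ≈⟨ zeroʳ _ ⟩
      0#                         ∎
      where
      bound : suc k ≤ k ∸ l ℕ.+ i
      bound = ≡.subst (_≤ k ∸ l ℕ.+ i)
        (≡.trans (ℕ.+-suc (k ∸ l) l) (≡.cong suc (ℕ.m∸n+n≡m (ℕ.≤-pred d<k))))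
        (ℕ.+-monoʳ-≤ (k ∸ l) l<a)

  Alternative : ∀ {I J : Set} → (I → J → Carrier) → (I → Carrier) → Set
  Alternative M v = InSpan M v ⊎ Certificate (P k) M v

  module Pivot {I : Set} {n} (M : I → Fin (suc n) → Carrier) (v : I → Carrier) (i₀ : I) (j₀ : Fin (suc n)) where
    private
      a = M i₀ j₀

    -- w ↦ w − w i₀ · col is the row operation; if w i₀ = x a it subtracts x times column j₀.
    reduce : (I → Carrier) → (I → Carrier) → I → Carrier
    reduce col w i = - w i₀ * col i + w i

    reduced : (I → Carrier) → I → Fin n → Carrier
    reduced col i j = reduce col (λ i → M i (punchIn j₀ j)) i

    module _ {col : I → Carrier} (column₀ : ∀ i → M i j₀ ≈ col i * a) where

      reduce-span : ∀ {w x} → w i₀ ≈ x * a → ∀ i → x * M i j₀ + reduce col w i ≈ w i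
      reduce-span {w} {x} w≈xa i = begin
        x * M i j₀ + (- w i₀ * col i + w i)          ≈⟨ +-cong (*-congˡ (column₀ i)) (+-congʳ (*-congʳ (-‿cong w≈xa))) ⟩
        x * (col i * a) + (- (x * a) * col i + w i)  ≈⟨ cancel-multiple x (col i) a (w i) ⟩
        w i                                          ∎

      -- Since the pivot divides its row, each reduced vector differs from the original one by a
      -- multiple of the pivot column. Hence the reduced columns lie in the span of `M`, and adding
      -- `e` times the pivot column recovers `v`.
      lift-span : (∀ j → ∃ λ q → M i₀ j ≈ q * a) → (∃ λ e → v i₀ ≈ e * a) →
        InSpan (reduced col) (reduce col v) → InSpan M v
      lift-span divs (e , v≈ea) s = span-resp (reduce-span v≈ea)
        (span-axpy e (span-gen j₀) (span-linear (λ w → w) (λ z → z) (λ z → z) gen s))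
        where
        gen : ∀ j → InSpan M (λ i → reduced col i j)
        gen j with divs (punchIn j₀ j)
        ... | x , M≈xa = span-resp
          (λ i → trans (+-congˡ (sym (reduce-span {λ i → M i (punchIn j₀ j)} M≈xa i))) (cancel-term x (M i j₀) _))
          (span-axpy (- x) (span-gen j₀) (span-gen (punchIn j₀ j)))

      -- The coefficient at `i₀` is the one that makes pairing with `y` the adjoint of `reduce`. The
      -- pivot column, which is missing from the reduced matrix, reduces to zero.
      lift-certificate : ∀ {s} → Certificate s (reduced col) (reduce col v) → Certificate s M v
      lift-certificate (y′ , kills , hits) = y , kills′ , trans (eval-y v) hits
        where
        y = (i₀ , - eval y′ col) ∷ y′

        eval-y : ∀ w → eval y w ≈ eval y′ (reduce col w)
        eval-y w = begin
          - eval y′ col * w i₀ + eval y′ w ≈⟨ +-congʳ (neg-*-swap (eval y′ col) (w i₀)) ⟩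
          - w i₀ * eval y′ col + eval y′ w ≈⟨ eval-axpy y′ {c = - w i₀} {col} (λ _ → refl) ⟨
          eval y′ (reduce col w)           ∎

        kills′ : ∀ j → eval y (λ i → M i j) ≈ 0#
        kills′ j with j₀ Fin.≟ j
        ... | yes ≡.refl = trans (eval-y (λ i → M i j))
          (eval-zero y′ (λ i → trans (+-congˡ (column₀ i)) (cancel-product a (col i))))
        ... | no j₀≢j = trans (eval-y (λ i → M i j))
          (≡.subst (λ l → eval y′ (reduce col (λ i → M i l)) ≈ 0#) (punchIn-punchOut j₀≢j) (kills (punchOut j₀≢j)))

  least-entry : ∀ {I : Set} (is : List I) → (∀ i → i ∈ is) → I → ∀ n (M : I → Fin (suc n) → Carrier) →
    Σ I λ i₀ → Σ (Fin (suc n)) λ j₀ → ∀ i j → ν (M i₀ j₀) ≤ ν (M i j)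
  least-entry {I} is ∈is i₁ n M = _ , _ , λ i j → All.lookup
    (f[argmin]≤f[xs] {f = λ p → ν (M (proj₁ p) (proj₂ p))} (i₁ , zero) (cartesianProduct is (allFin (suc n))))
    (∈-cartesianProduct⁺ (∈is i) (∈-allFin j))

  -- Gaussian elimination, pivoting on an entry of least valuation so that it divides all others.
  fredholm : ∀ {I : Set} (is : List I) → (∀ i → i ∈ is) →
    ∀ n (M : I → Fin n → Carrier) v → Alternative M v
  fredholm is ∈is zero M v with All.all? (λ i → suc k ℕ.≤? ν (v i)) is
  ... | yes top = inj₁ (nil (λ i → ν-top (v i) (All.lookup top (∈is i))))
  ... | no ¬top with find (¬All⇒Any¬ (λ i → suc k ℕ.≤? ν (v i)) is ¬top)
  ...   | i , _ , vi<k with separate (v i) (ℕ.≰⇒> vi<k)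
  ...     | c , hit , _ = inj₂ ((i , c) ∷ [] , (λ ()) , trans (+-identityʳ _) hit)
  fredholm [] ∈is (suc n) M v = inj₁ (nil empty)
    where
    empty : ∀ i → v i ≈ 0#
    empty i with () ← ∈is i
  fredholm is@(i₁ ∷ _) ∈is (suc n) M v = step (least-entry is ∈is i₁ n M)
    where
    step : (Σ _ λ i₀ → Σ (Fin (suc n)) λ j₀ → ∀ i j → ν (M i₀ j₀) ≤ ν (M i j)) → Alternative M v
    step (i₀ , j₀ , least) = by-divisibility (ν a ℕ.≤? ν (v i₀))
      where
      open Pivot M v i₀ j₀
      a = M i₀ j₀

      by-divisibility : Dec (ν a ≤ ν (v i₀)) → Alternative M v
      -- Here `v i₀` has smaller valuation than every entry of row `i₀`, so this row alone is
      -- contradictory.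
      by-divisibility (no a≰v) =
        let c , hit , kill = separate (v i₀) (ℕ.<-≤-trans (ℕ.≰⇒> a≰v) (proj₁ (proj₂ (val a))))
        in inj₂ ((i₀ , c) ∷ []
          , (λ j → trans (+-identityʳ _) (kill (M i₀ j) (ℕ.<-≤-trans (ℕ.≰⇒> a≰v) (least i₀ j))))
          , trans (+-identityʳ _) hit)
      by-divisibility (yes a≤v) = Sum.map
        (lift-span column₀ (λ j → ν-divides a (M i₀ j) (least i₀ j)) (ν-divides a (v i₀) a≤v))
        (lift-certificate column₀)
        -- Only the columns decrease in number. The pivot row stays among the rows, but it has
        -- become zero on both sides.
        (fredholm is ∈is n (reduced col) (reduce col v))
        where
        col : _ → Carrier
        col i = proj₁ (ν-divides a (M i j₀) (least i j₀))

        column₀ : ∀ i → M i j₀ ≈ col i * a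
        column₀ i = proj₂ (ν-divides a (M i j₀) (least i j₀))

-- Duality over a finite ring of prime-power characteristic

open import Defs

commRing : FinCommRing → CommutativeRing 0ℓ 0ℓ
commRing R = record { isCommutativeRing = isCommRing R }

divisors-of-prime-power : ∀ {p d} → Prime p → ∀ n → d ∣ p ^ n → ∃ λ i → i ≤ n × d ≡ p ^ i
divisors-of-prime-power pr zero d∣1 = 0 , z≤n , ∣1⇒≡1 d∣1
divisors-of-prime-power {p} {d} pr (suc n) d∣ with p ∣? d
... | no p∤d = map₂ (λ (i≤n , e) → ℕ.m≤n⇒m≤1+n i≤n , e) (divisors-of-prime-power pr n (coprime-divisor coprime d∣))
  where
  coprime : ∀ {e} → e ∣ d × e ∣ p → e ≡ 1
  coprime (e∣d , e∣p) with prime⇒irreducible pr e∣p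
  ... | inj₁ e≡1 = e≡1
  ... | inj₂ ≡.refl = contradiction e∣d p∤d
... | yes (divides q ≡.refl) = let i , i≤n , q≡pⁱ = divisors-of-prime-power pr n q∣
                               in suc i , s≤s i≤n , ≡.trans (ℕ.*-comm q p) (≡.cong (p ℕ.*_) q≡pⁱ)
  where
  q∣ : q ∣ p ^ n
  q∣ = *-cancelˡ-∣ p {{prime⇒nonZero pr}} (≡.subst (_∣ p ^ suc n) (ℕ.*-comm q p) d∣)

-- The prime subring ℤ/pᵏ⁺¹ of R, represented by natural numbers.
module PrimeSubring (R : FinCommRing) {p : ℕ} (k : ℕ) (pr : Prime p) (char : IsCharacteristic R (p ^ suc k)) where
  open CommutativeRing (commRing R) hiding (zero; Carrier)
  open Algebra.Properties.Ring ring using (-‿distribʳ-*)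
  open Algebra.Properties.AbelianGroup +-abelianGroup using (inverseʳ-unique)
  open ≡-Reasoning

  ι : ℕ → Carrier R
  ι = natᴿ R

  ι-+ : ∀ m n → ι (m ℕ.+ n) ≡ ι m + ι n
  ι-+ zero    n = sym (+-identityˡ (ι n))
  ι-+ (suc m) n = ≡.trans (≡.cong (1# +_) (ι-+ m n)) (sym (+-assoc 1# (ι m) (ι n)))

  ι-* : ∀ m n → ι (m ℕ.* n) ≡ ι m * ι n
  ι-* zero    n = sym (zeroˡ (ι n))
  ι-* (suc m) n = begin
    ι (n ℕ.+ m ℕ.* n)       ≡⟨ ι-+ n (m ℕ.* n) ⟩
    ι n + ι (m ℕ.* n)       ≡⟨ ≡.cong₂ _+_ (sym (*-identityˡ (ι n))) (ι-* m n) ⟩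
    1# * ι n + ι m * ι n    ≡⟨ distribʳ (ι n) 1# (ι m) ⟨
    (1# + ι m) * ι n        ∎

  ι-char : ι (p ^ suc k) ≡ 0#
  ι-char = proj₁ (proj₂ char)

  private
    -- The natural number pᵏ⁺¹ - 1 represents -1.
    negate : ℕ → ℕ
    negate n = n ℕ.* ℕ.pred (p ^ suc k)

    ι-pred : ι (ℕ.pred (p ^ suc k)) ≡ - 1#
    ι-pred = inverseʳ-unique 1# _ (≡.trans (≡.cong ι (ℕ.suc-pred (p ^ suc k) {{ℕ.>-nonZero (proj₁ char)}})) ι-char)

    ι-negate : ∀ n → ι (negate n) ≡ - ι n
    ι-negate n = begin
      ι (n ℕ.* ℕ.pred (p ^ suc k))  ≡⟨ ι-* n _ ⟩
      ι n * ι (ℕ.pred (p ^ suc k))  ≡⟨ ≡.cong (ι n *_) ι-pred ⟩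
      ι n * - 1#                    ≡⟨ -‿distribʳ-* (ι n) 1# ⟨
      - (ι n * 1#)                  ≡⟨ ≡.cong -_ (*-identityʳ (ι n)) ⟩
      - ι n                         ∎

    rawRingℕ : RawRing 0ℓ 0ℓ
    rawRingℕ = record
      { Carrier = ℕ ; _≈_ = λ m n → ι m ≡ ι n ; _+_ = ℕ._+_ ; _*_ = ℕ._*_ ; -_ = negate ; 0# = 0 ; 1# = 1 }

  ι-1 : ι 1 ≡ 1#
  ι-1 = +-identityʳ 1#

  -- The axioms are pulled back along `ι`, which is injective because equality of scalars is
  -- equality of their images in R. No residues have to be computed.
  scalars : CommutativeRing 0ℓ 0ℓ
  scalars = record { isCommutativeRing = RingMonomorphism.isCommutativeRing mono (isCommRing R) }
    where
    mono : IsRingMonomorphism rawRingℕ (CommutativeRing.rawRing (commRing R)) ι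
    mono = record
      { isRingHomomorphism = record
        { isSemiringHomomorphism = record
          { isNearSemiringHomomorphism = record
            { +-isMonoidHomomorphism = record
              { isMagmaHomomorphism = record { isRelHomomorphism = record { cong = λ e → e } ; homo = ι-+ }
              ; ε-homo = ≡.refl }
            ; *-homo = ι-* }
          ; 1#-homo = ι-1 }
        ; -‿homo = ι-negate }
      ; injective = λ e → e }

  ι-negative : ∀ n → ι (CommutativeRing.-_ scalars n) ≡ - ι n
  ι-negative = ι-negate

  ι-multiple : ∀ m → ι (m ℕ.* p ^ suc k) ≡ 0#
  ι-multiple m = ≡.trans (ι-* m _) (≡.trans (≡.cong (ι m *_) ι-char) (zeroʳ (ι m)))

  private
    -- The gcd of `a` and pᵏ⁺¹ is a power of p dividing `a`; Bézout's identity, read modulo the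
    -- characteristic, makes it a multiple of `a` as well.
    associate : ∀ a → Σ ℕ λ i → i ≤ suc k × (∃ λ q → ι a ≡ ι (q ℕ.* p ^ i)) × (∃ λ c → ι (p ^ i) ≡ ι (c ℕ.* a))
    associate a with Bézout.lemma a (p ^ suc k)
    ... | Bézout.result d g bez with divisors-of-prime-power pr (suc k) (proj₂ (GCD.commonDivisor g))
    ...   | i , i≤k , ≡.refl = i , i≤k , (quotient d∣a , ≡.cong ι (m∣n⇒n≡quotient*m d∣a)) , inverse bez
      where
      d∣a : p ^ i ∣ a
      d∣a = proj₁ (GCD.commonDivisor g)

      inverse : Bézout.Identity (p ^ i) a (p ^ suc k) → ∃ λ c → ι (p ^ i) ≡ ι (c ℕ.* a)
      inverse (Bézout.+- x y e) = x , (begin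
        ι (p ^ i)                              ≡⟨ +-identityʳ _ ⟨
        ι (p ^ i) + 0#                         ≡⟨ ≡.cong (ι (p ^ i) +_) (ι-multiple y) ⟨
        ι (p ^ i) + ι (y ℕ.* p ^ suc k)        ≡⟨ ι-+ (p ^ i) _ ⟨
        ι (p ^ i ℕ.+ y ℕ.* p ^ suc k)          ≡⟨ ≡.cong ι e ⟩
        ι (x ℕ.* a)                            ∎)
      inverse (Bézout.-+ x y e) = negate x , (begin
        ι (p ^ i)                     ≡⟨ inverseʳ-unique _ _ (begin
          ι (x ℕ.* a) + ι (p ^ i)       ≡⟨ +-comm _ _ ⟩
          ι (p ^ i) + ι (x ℕ.* a)       ≡⟨ ι-+ (p ^ i) _ ⟨
          ι (p ^ i ℕ.+ x ℕ.* a)         ≡⟨ ≡.cong ι e ⟩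
          ι (y ℕ.* p ^ suc k)           ≡⟨ ι-multiple y ⟩
          0#                            ∎) ⟩
        - ι (x ℕ.* a)                 ≡⟨ ≡.cong -_ (ι-* x a) ⟩
        - (ι x * ι a)                 ≡⟨ Algebra.Properties.Ring.-‿distribˡ-* ring (ι x) (ι a) ⟩
        - ι x * ι a                   ≡⟨ ≡.cong (_* ι a) (ι-negate x) ⟨
        ι (negate x) * ι a               ≡⟨ ι-* (negate x) a ⟨
        ι (negate x ℕ.* a)               ∎)

  uniformised : Uniformised scalars k
  uniformised = record
    { P     = p ^_
    ; P-+   = λ i j → ≡.cong ι (ℕ.^-distribˡ-+-* p i j)
    ; P-top = ι-char
    ; val   = associate
    }

  -- The generator of the least nonzero ideal of ℤ/pᵏ⁺¹.
  socle : Carrier R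
  socle = ι (p ^ k)

  socle≢0 : socle ≢ 0#
  socle≢0 = proj₂ (proj₂ char) (p ^ k) (ℕ.m^n>0 p {{prime⇒nonZero pr}} k)
    (ℕ.^-monoʳ-< p (ℕ.nonTrivial⇒n>1 p {{prime⇒nonTrivial pr}}) (ℕ.n<1+n k))

  -- An element of positive valuation annihilates the socle.
  unit : ∀ a → ι a * socle ≡ socle → ∃ λ c → ι c * ι a ≡ 1#
  unit a aσ≡σ with associate a
  ... | zero  , _ , _ , c , e = c , ≡.trans (sym (ι-* c a)) (≡.trans (sym e) ι-1)
  ... | suc i , _ , (q , e) , _ = contradiction (≡.trans (sym aσ≡σ) (begin
    ι a * socle                       ≡⟨ ≡.cong (_* socle) e ⟩
    ι (q ℕ.* p ^ suc i) * socle       ≡⟨ ι-* (q ℕ.* p ^ suc i) (p ^ k) ⟨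
    ι (q ℕ.* p ^ suc i ℕ.* p ^ k)     ≡⟨ ≡.cong ι rearrange ⟩
    ι (q ℕ.* p ^ i ℕ.* p ^ suc k)     ≡⟨ ι-multiple (q ℕ.* p ^ i) ⟩
    0#                                ∎)) socle≢0
    where
    rearrange : q ℕ.* p ^ suc i ℕ.* p ^ k ≡ q ℕ.* p ^ i ℕ.* p ^ suc k
    rearrange = begin
      q ℕ.* (p ℕ.* p ^ i) ℕ.* p ^ k     ≡⟨ ≡.cong (λ x → q ℕ.* x ℕ.* p ^ k) (ℕ.*-comm p (p ^ i)) ⟩
      q ℕ.* (p ^ i ℕ.* p) ℕ.* p ^ k     ≡⟨ ≡.cong (ℕ._* p ^ k) (ℕ.*-assoc q (p ^ i) p) ⟨
      q ℕ.* p ^ i ℕ.* p ℕ.* p ^ k       ≡⟨ ℕ.*-assoc (q ℕ.* p ^ i) p (p ^ k) ⟩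
      q ℕ.* p ^ i ℕ.* p ^ suc k         ∎

-- The dual of M x = v has unknowns yᵢ(t), i ∈ I, t ∈ R, and equations
--   yᵢ(r + s) − yᵢ(r) − yᵢ(s) = 0,   Σᵢ yᵢ(r Mᵢⱼ) = 0,   Σᵢ yᵢ(vᵢ) = pᵏ,
-- where pᵏ⁺¹ is the characteristic.  A solution consists of additive functionals yᵢ separating v from the column
-- span of M.
module Dual (R : FinCommRing) {p : ℕ} (k : ℕ) (pr : Prime p) (char : IsCharacteristic R (p ^ suc k)) where
  open CommutativeRing (commRing R) hiding (zero; Carrier)
  open Algebra.Properties.AbelianGroup +-abelianGroup using (⁻¹-∙-comm; ⁻¹-involutive; inverseʳ-unique)
  open Algebra.Properties.Ring ring using (-1*x≈-x; -‿distribˡ-*; -‿distribʳ-*)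
  open PrimeSubring R k pr char
  open Span (commRing R)
  open ≡-Reasoning
  private
    module S = CommutativeRing scalars
    module Spanˢ = Span scalars
    module Fredholmˢ = Fredholm uniformised

  DualTag : Set
  DualTag = (Carrier R × Carrier R) ⊎ Carrier R ⊎ ⊤

  dualTags : List DualTag
  dualTags = List.map inj₁ (cartesianProduct (allFin _) (allFin _)) List.++
    List.map (inj₂ ∘ inj₁) (allFin _) List.++ inj₂ (inj₂ _) ∷ []

  ∈-dualTags : ∀ τ → τ ∈ dualTags
  ∈-dualTags (inj₁ (r , s)) = ∈-++⁺ˡ (∈-map⁺ inj₁ (∈-cartesianProduct⁺ (∈-allFin r) (∈-allFin s)))
  ∈-dualTags (inj₂ (inj₁ r)) =
    ∈-++⁺ʳ (List.map inj₁ (cartesianProduct (allFin (size R)) (allFin (size R))))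
      (∈-++⁺ˡ (∈-map⁺ (inj₂ ∘ inj₁) (∈-allFin r)))
  ∈-dualTags (inj₂ (inj₂ _)) =
    ∈-++⁺ʳ (List.map inj₁ (cartesianProduct (allFin (size R)) (allFin (size R))))
      (∈-++⁺ʳ (List.map (inj₂ ∘ inj₁) (allFin (size R))) (here ≡.refl))

  -- The coefficient of the unknown y(t) in the expression y(r). Likewise `additivity r s t` is its
  -- coefficient in y(r + s) - y(r) - y(s).
  δ : Carrier R → Carrier R → ℕ
  δ r t = if does (t Fin.≟ r) then 1 else 0

  additivity : Carrier R → Carrier R → Carrier R → ℕ
  additivity r s t = S.- 1 ℕ.* δ r t ℕ.+ (S.- 1 ℕ.* δ s t ℕ.+ δ (r + s) t)

  dualTarget : DualTag → ℕ
  dualTarget (inj₁ _)        = 0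
  dualTarget (inj₂ (inj₁ _)) = 0
  dualTarget (inj₂ (inj₂ _)) = p ^ k

  module _ {I J : Set} (_≟_ : DecidableEquality I) (M : I → J → Carrier R) (v : I → Carrier R) where

    -- Column (t , i) stands for the unknown yᵢ(t). Entries are natural numbers so that one system
    -- can be read both over the prime subring, for the elimination, and over R. All three families
    -- of equations share one index type; the repetitions that this creates do not affect
    -- solvability.
    dualℕ : DualTag × I × J → Carrier R × I → ℕ
    dualℕ (inj₁ (r , s) , i , j)   (t , i′) = if does (i ≟ i′) then additivity r s t else 0
    dualℕ (inj₂ (inj₁ r) , i , j)  (t , i′) = δ (r * M i′ j) t
    dualℕ (inj₂ (inj₂ _) , i , j)  (t , i′) = δ (v i′) t

    dual : DualTag × I × J → Carrier R × I → Carrier R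
    dual ρ c = ι (dualℕ ρ c)

    DualSolvable : Set
    DualSolvable = InSpan dual (λ ρ → ι (dualTarget (proj₁ ρ)))

  ι-minus-1 : ι (S.- 1) ≡ - 1#
  ι-minus-1 = ≡.trans (ι-negative 1) (≡.cong -_ ι-1)

  ι-additivity : ∀ r s t → ι (additivity r s t) ≡ - 1# * ι (δ r t) + (- 1# * ι (δ s t) + ι (δ (r + s) t))
  ι-additivity r s t = begin
    ι (additivity r s t)
      ≡⟨ ≡.trans (ι-+ (S.- 1 ℕ.* δ r t) _) (≡.cong (_ +_) (ι-+ (S.- 1 ℕ.* δ s t) _)) ⟩
    ι (S.- 1 ℕ.* δ r t) + (ι (S.- 1 ℕ.* δ s t) + ι (δ (r + s) t))
      ≡⟨ ≡.cong₂ (λ x y → x + (y + ι (δ (r + s) t))) (minus-1 r) (minus-1 s) ⟩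
    - 1# * ι (δ r t) + (- 1# * ι (δ s t) + ι (δ (r + s) t)) ∎
    where
    minus-1 : ∀ r → ι (S.- 1 ℕ.* δ r t) ≡ - 1# * ι (δ r t)
    minus-1 r = ≡.trans (ι-* (S.- 1) (δ r t)) (≡.cong (_* ι (δ r t)) ι-minus-1)

  cancel-both : ∀ x y → - 1# * x + (- 1# * y + (x + y)) ≡ 0#
  cancel-both x y = begin
    - 1# * x + (- 1# * y + (x + y)) ≡⟨ +-assoc _ _ _ ⟨
    - 1# * x + - 1# * y + (x + y)   ≡⟨ ≡.cong (_+ (x + y)) (≡.cong₂ _+_ (-1*x≈-x x) (-1*x≈-x y)) ⟩
    - x + - y + (x + y)             ≡⟨ ≡.cong (_+ (x + y)) (⁻¹-∙-comm x y) ⟩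
    - (x + y) + (x + y)             ≡⟨ -‿inverseˡ (x + y) ⟩
    0#                              ∎

  neg-neg : ∀ x y → - x * - y ≡ x * y
  neg-neg x y = begin
    - x * - y      ≡⟨ -‿distribˡ-* x (- y) ⟨
    - (x * - y)    ≡⟨ ≡.cong -_ (-‿distribʳ-* x y) ⟨
    - - (x * y)    ≡⟨ ⁻¹-involutive (x * y) ⟩
    x * y          ∎

  module _ {I J : Set} (_≟_ : DecidableEquality I) (is : List I) (∈is : ∀ i → i ∈ is)
    {M : I → J → Carrier R} {v : I → Carrier R} where

    -- A solution defines the functional Y w = Σᵢ yᵢ(wᵢ). The first two families of equations make Y
    -- vanish on the span of `M`, whereas the last one gives Y v = pᵏ ≠ 0. The arguments `i₀` and
    -- `j₀` fill those coordinates of a row index on which its equation does not depend.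
    dual-sound : I → J → DualSolvable _≟_ M v → ¬ InSpan M v
    dual-sound i₀ j₀ s v∈M = socle≢0 (≡.trans (eqn (inj₂ (inj₂ _) , i₀ , j₀)) (Y-span v∈M))
      where
      y : List ((Carrier R × I) × Carrier R)
      y = proj₁ (span-coefficients s)

      eqn : ∀ ρ → ι (dualTarget (proj₁ ρ)) ≡ eval y (dual _≟_ M v ρ)
      eqn = proj₂ (span-coefficients s)

      Y : (I → Carrier R) → Carrier R
      Y w = eval y (λ (t , i) → ι (δ (w i) t))

      Y-cong : ∀ {w u} → (∀ i → w i ≡ u i) → Y w ≡ Y u
      Y-cong w≡u = eval-cong y (λ (t , i) → ≡.cong (λ r → ι (δ r t)) (w≡u i))

      Y-multiple : ∀ c j → Y (λ i → c * M i j) ≡ 0#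
      Y-multiple c j = sym (eqn (inj₂ (inj₁ c) , i₀ , j))

      ι-if : ∀ b n → ι (if b then n else 0) ≡ (if b then ι n else 0#)
      ι-if true  n = ≡.refl
      ι-if false n = ≡.refl

      rows : List (I × Carrier R)
      rows = List.map (λ i → i , 1#) (deduplicate _≟_ is)

      -- The dual states additivity separately for each i′. Summing these equations over a
      -- duplicate-free list of rows gives additivity of Y, since the test i′ = i lets each unknown
      -- contribute exactly once.
      Y-additive : ∀ w u → - 1# * Y w + (- 1# * Y u + Y (λ i → w i + u i)) ≡ 0#
      Y-additive w u = begin
        - 1# * Y w + (- 1# * Y u + Y (λ i → w i + u i))
          ≡⟨ ≡.cong (- 1# * Y w +_) (eval-axpy y {c = - 1#} {λ (t , i) → ι (δ (u i) t)} (λ _ → ≡.refl)) ⟨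
        - 1# * Y w + eval y (λ (t , i) → - 1# * ι (δ (u i) t) + ι (δ (w i + u i) t))
          ≡⟨ eval-axpy y {c = - 1#} {λ (t , i) → ι (δ (w i) t)} (λ (t , i) → ι-additivity (w i) (u i) t) ⟨
        eval y (λ (t , i) → ι (additivity (w i) (u i) t))
          ≡⟨ eval-cong y (λ (t , i) → ≡.trans
               (eval-cong rows (λ i′ → ι-if (does (i′ ≟ i)) _))
               (≡.trans (eval-indicator _≟_ (λ _ → 1#) (λ i → ι (additivity (w i) (u i) t))
                          (deduplicate-! _≟_ is) (∈-deduplicate⁺ _≟_ (∈is i)))
                        (*-identityˡ _))) ⟨
        eval y (λ (t , i) → eval rows (λ i′ → ι (if does (i′ ≟ i) then additivity (w i′) (u i′) t else 0)))
          ≡⟨ eval-swap y rows _ ⟩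
        eval rows (λ i′ → eval y (λ (t , i) → ι (if does (i′ ≟ i) then additivity (w i′) (u i′) t else 0)))
          ≡⟨ eval-zero rows (λ i′ → sym (eqn (inj₁ (w i′ , u i′) , i′ , j₀))) ⟩
        0# ∎

      third-zero : ∀ {a b c} → a ≡ 0# → b ≡ 0# → - 1# * a + (- 1# * b + c) ≡ 0# → c ≡ 0#
      third-zero {c = c} ≡.refl ≡.refl e = begin
        c                                  ≡⟨ ≡.trans (+-identityˡ _) (+-identityˡ c) ⟨
        0# + (0# + c)                      ≡⟨ ≡.cong (λ x → x + (x + c)) (zeroʳ (- 1#)) ⟨
        - 1# * 0# + (- 1# * 0# + c)        ≡⟨ e ⟩
        0#                                 ∎

      Y-span : ∀ {w} → InSpan M w → Y w ≡ 0#
      -- That Y vanishes at zero is read off the equation for the multiple 0 of column `j₀`.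
      Y-span (nil w≡0) = ≡.trans (Y-cong (λ i → ≡.trans (w≡0 i) (sym (zeroˡ (M i j₀))))) (Y-multiple 0# j₀)
      Y-span (cons {w = u} j c u∈M e) = ≡.trans (Y-cong e)
        (third-zero (Y-multiple c j) (Y-span u∈M) (Y-additive (λ i → c * M i j) u))

    span-ι : ∀ {A B : Set} {N : A → B → ℕ} {w} → Spanˢ.InSpan N w → InSpan (λ a b → ι (N a b)) (λ a → ι (w a))
    span-ι (Spanˢ.nil w≡0)      = nil w≡0
    span-ι {N = N} (Spanˢ.cons {w = u} j c s e) = cons j (ι c) (span-ι s) (λ i → ≡.trans (e i)
      (≡.trans (ι-+ (c ℕ.* N i j) (u i)) (≡.cong (_+ ι (u i)) (ι-* c (N i j)))))

    eval-ι : ∀ {A : Set} (y : List (A × ℕ)) w →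
      ι (Spanˢ.eval y w) ≡ eval (List.map (map₂ ι) y) (λ a → ι (w a))
    eval-ι []            w = ≡.refl
    eval-ι ((a , c) ∷ y) w = ≡.trans (ι-+ (c ℕ.* w a) (Spanˢ.eval y w)) (≡.cong₂ _+_ (ι-* c (w a)) (eval-ι y w))

    -- Summing t times the t-th column of the dual system over t ∈ R recovers M and v from it.
    weighted : List (Carrier R × Carrier R)
    weighted = List.map (λ t → t , t) (allFin (size R))

    recovered : DualTag × I × J → I → Carrier R
    recovered (inj₁ _ , _)            i = 0#
    recovered (inj₂ (inj₁ r) , _ , j) i = r * M i j
    recovered (inj₂ (inj₂ _) , _)     i = v i

    weighted-δ : ∀ r → eval weighted (λ t → ι (δ r t)) ≡ r
    weighted-δ r = begin
      eval weighted (λ t → ι (δ r t))                               ≡⟨ eval-cong weighted (λ t → pull (does (t Fin.≟ r))) ⟩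
      eval weighted (λ t → if does (t Fin.≟ r) then 1# else 0#)     ≡⟨
        eval-indicator Fin._≟_ (λ t → t) (λ _ → 1#) (allFin⁺ _) (∈-allFin r) ⟩
      r * 1#                                                        ≡⟨ *-identityʳ r ⟩
      r                                                             ∎
      where
      pull : ∀ b → ι (if b then 1 else 0) ≡ (if b then 1# else 0#)
      pull true  = ι-1
      pull false = ≡.refl

    weighted-additivity : ∀ r s → eval weighted (λ t → ι (additivity r s t)) ≡ 0#
    weighted-additivity r s = begin
      eval weighted (λ t → ι (additivity r s t))
        ≡⟨ eval-axpy weighted {c = - 1#} {λ t → ι (δ r t)} (ι-additivity r s) ⟩
      - 1# * eval weighted (λ t → ι (δ r t)) + eval weighted (λ t → - 1# * ι (δ s t) + ι (δ (r + s) t))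
        ≡⟨ ≡.cong₂ (λ x y → - 1# * x + y) (weighted-δ r)
             (eval-axpy weighted {c = - 1#} {λ t → ι (δ s t)} (λ _ → ≡.refl)) ⟩
      - 1# * r + (- 1# * eval weighted (λ t → ι (δ s t)) + eval weighted (λ t → ι (δ (r + s) t)))
        ≡⟨ ≡.cong₂ (λ x y → - 1# * r + (- 1# * x + y)) (weighted-δ s) (weighted-δ (r + s)) ⟩
      - 1# * r + (- 1# * s + (r + s))
        ≡⟨ cancel-both r s ⟩
      0# ∎

    weighted-dual : ∀ ρ i → eval weighted (λ t → dual _≟_ M v ρ (t , i)) ≡ recovered ρ i
    weighted-dual (inj₁ (r , s) , i′ , _) i with i′ ≟ i
    ... | yes _ = weighted-additivity r s
    ... | no  _ = eval-zero weighted (λ _ → ≡.refl)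
    weighted-dual (inj₂ (inj₁ r) , _ , j) i = weighted-δ (r * M i j)
    weighted-dual (inj₂ (inj₂ _) , _)     i = weighted-δ (v i)

    -- Here `a` adds up the multipliers of all copies of the last equation and `z` collects the
    -- multiples of columns of `M`; additivity equations leave no trace, because the identity
    -- function is additive.
    target-coefficient : ∀ (y : List ((DualTag × I × J) × ℕ)) → ∃ λ a → Σ (I → Carrier R) λ z → InSpan M z ×
      (∀ i → eval (List.map (map₂ ι) y) (λ ρ → recovered ρ i) ≡ ι a * v i + z i) ×
      eval (List.map (map₂ ι) y) (λ ρ → ι (dualTarget (proj₁ ρ))) ≡ ι a * socle
    target-coefficient [] = 0 , (λ _ → 0#) , nil (λ _ → ≡.refl)
      , (λ i → sym (≡.trans (+-identityʳ _) (zeroˡ (v i)))) , sym (zeroˡ socle)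
    target-coefficient (((inj₁ _ , _) , c) ∷ y) with target-coefficient y
    ... | a , z , z∈M , e , f = a , z , z∈M , (λ i → skip (e i)) , skip f
      where
      skip : ∀ {x x′} → x ≡ x′ → ι c * 0# + x ≡ x′
      skip x≡x′ = ≡.trans (≡.cong₂ _+_ (zeroʳ (ι c)) x≡x′) (+-identityˡ _)
    target-coefficient (((inj₂ (inj₁ r) , _ , j) , c) ∷ y) with target-coefficient y
    ... | a , z , z∈M , e , f = a , (λ i → ι c * r * M i j + z i) , cons j (ι c * r) z∈M (λ _ → ≡.refl)
      , (λ i → begin
          ι c * (r * M i j) + eval (List.map (map₂ ι) y) (λ ρ → recovered ρ i)
            ≡⟨ ≡.cong₂ _+_ (sym (*-assoc (ι c) r (M i j))) (e i) ⟩
          ι c * r * M i j + (ι a * v i + z i)  ≡⟨ +-assoc _ _ _ ⟨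
          ι c * r * M i j + ι a * v i + z i    ≡⟨ ≡.cong (_+ z i) (+-comm _ _) ⟩
          ι a * v i + ι c * r * M i j + z i    ≡⟨ +-assoc _ _ _ ⟩
          ι a * v i + (ι c * r * M i j + z i)  ∎)
      , ≡.trans (≡.cong₂ _+_ (zeroʳ (ι c)) f) (+-identityˡ _)
    target-coefficient (((inj₂ (inj₂ _) , _) , c) ∷ y) with target-coefficient y
    ... | a , z , z∈M , e , f = c ℕ.+ a , z , z∈M
      , (λ i → begin
          ι c * v i + eval (List.map (map₂ ι) y) (λ ρ → recovered ρ i)  ≡⟨ ≡.cong (ι c * v i +_) (e i) ⟩
          ι c * v i + (ι a * v i + z i)  ≡⟨ +-assoc _ _ _ ⟨
          ι c * v i + ι a * v i + z i    ≡⟨ ≡.cong (_+ z i) (collect (v i)) ⟩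
          ι (c ℕ.+ a) * v i + z i        ∎)
      , ≡.trans (≡.cong (ι c * socle +_) f) (collect socle)
      where
      collect : ∀ x → ι c * x + ι a * x ≡ ι (c ℕ.+ a) * x
      collect x = ≡.trans (sym (distribʳ x (ι c) (ι a))) (≡.cong (_* x) (sym (ι-+ c a)))

    -- The alternative is applied to the dual over the prime subring. A solution there is also a
    -- solution over R. A certificate becomes, on weighting by t, a relation a v + z = 0 with z in
    -- the span of `M`, and a turns out to be invertible.
    dual-complete : (js : List J) → (∀ j → j ∈ js) → DualSolvable _≟_ M v ⊎ InSpan M v
    dual-complete js ∈js = Sum.map solvable certified
      (Fredholmˢ.fredholm rows ∈rows (List.length cols)
        (λ ρ l → dualℕ _≟_ M v ρ (List.lookup cols l)) (λ ρ → dualTarget (proj₁ ρ)))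
      where
      rows = cartesianProduct dualTags (cartesianProduct is js)
      cols = cartesianProduct (allFin (size R)) is

      ∈rows : ∀ ρ → ρ ∈ rows
      ∈rows (τ , i , j) = ∈-cartesianProduct⁺ (∈-dualTags τ) (∈-cartesianProduct⁺ (∈is i) (∈js j))

      solvable : Spanˢ.InSpan (λ ρ l → dualℕ _≟_ M v ρ (List.lookup cols l)) (λ ρ → dualTarget (proj₁ ρ)) →
        DualSolvable _≟_ M v
      solvable s = span-pull (λ ρ → ρ) (λ l → span-gen (List.lookup cols l)) (span-ι s)

      certified : Spanˢ.Certificate (p ^ k) (λ ρ l → dualℕ _≟_ M v ρ (List.lookup cols l)) (λ ρ → dualTarget (proj₁ ρ)) →
        InSpan M v
      certified (yℕ , kills , hits) with target-coefficient yℕ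
      ... | a , z , z∈M , e , f = span-resp combine (span-scale (- ι c) z∈M)
        where
        y = List.map (map₂ ι) yℕ

        -- The value of the certificate on the right-hand side is pᵏ, but also a pᵏ. Thus a fixes
        -- the socle, which only units of the prime subring do.
        inverse : ∃ λ c → ι c * ι a ≡ 1#
        inverse = unit a (≡.trans (sym f) (≡.trans (sym (eval-ι yℕ _)) hits))

        c = proj₁ inverse

        column : ∀ t i → eval y (λ ρ → dual _≟_ M v ρ (t , i)) ≡ 0#
        column t i = ≡.subst (λ q → eval y (λ ρ → dual _≟_ M v ρ q) ≡ 0#) (≡.sym (lookup-index q∈))
          (≡.trans (sym (eval-ι yℕ _)) (kills (index q∈)))
          where q∈ = ∈-cartesianProduct⁺ (∈-allFin t) (∈is i)

        relation : ∀ i → ι a * v i + z i ≡ 0#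
        relation i = begin
          ι a * v i + z i                                                   ≡⟨ e i ⟨
          eval y (λ ρ → recovered ρ i)                                      ≡⟨ eval-cong y (λ ρ → weighted-dual ρ i) ⟨
          eval y (λ ρ → eval weighted (λ t → dual _≟_ M v ρ (t , i)))       ≡⟨ eval-swap y weighted _ ⟩
          eval weighted (λ t → eval y (λ ρ → dual _≟_ M v ρ (t , i)))       ≡⟨ eval-zero weighted (λ t → column t i) ⟩
          0#                                                                ∎

        combine : ∀ i → - ι c * z i ≡ v i
        combine i = begin
          - ι c * z i              ≡⟨ ≡.cong (- ι c *_) (inverseʳ-unique _ _ (relation i)) ⟩
          - ι c * - (ι a * v i)    ≡⟨ neg-neg (ι c) (ι a * v i) ⟩
          ι c * (ι a * v i)        ≡⟨ *-assoc _ _ _ ⟨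
          ι c * ι a * v i          ≡⟨ ≡.cong (_* v i) (proj₂ inverse) ⟩
          1# * v i                 ≡⟨ *-identityˡ (v i) ⟩
          v i                      ∎

open Equivalence using (to; from)

-- Solvability of interpreted systems

vectors : ∀ n d → List (Vec (Fin n) d)
vectors n zero    = [] ∷ []
vectors n (suc d) = cartesianProductWith _∷_ (allFin n) (vectors n d)

∈-vectors : ∀ {n d} (y : Vec (Fin n) d) → y ∈ vectors n d
∈-vectors []      = here ≡.refl
∈-vectors (x ∷ y) = ∈-cartesianProductWith⁺ _∷_ (∈-allFin x) (∈-vectors y)

module _ (R : FinCommRing) where
  open CommutativeRing (commRing R) hiding (zero; Carrier)
  open Span (commRing R)
  open ≡-Reasoning

  span-sumᴿ : ∀ {I : Set} m (A : I → Fin m → Carrier R) (x : Fin m → Carrier R) →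
    InSpan A (λ i → sumᴿ R m (λ j → A i j * x j))
  span-sumᴿ zero    A x = nil (λ _ → ≡.refl)
  span-sumᴿ (suc m) A x = cons zero (x zero)
    (span-pull (λ i → i) (λ j → span-gen (suc j)) (span-sumᴿ m (λ i → A i ∘ suc) (x ∘ suc)))
    (λ i → +-congʳ (*-comm (A i zero) (x zero)))

  sumᴿ-zero : ∀ m {f : Fin m → Carrier R} → (∀ j → f j ≡ 0#) → sumᴿ R m f ≡ 0#
  sumᴿ-zero zero    f≡0 = ≡.refl
  sumᴿ-zero (suc m) f≡0 = ≡.trans (≡.cong₂ _+_ (f≡0 zero) (sumᴿ-zero m (f≡0 ∘ suc))) (+-identityˡ 0#)

  bump : ∀ {m} → Fin m → Carrier R → (Fin m → Carrier R) → Fin m → Carrier R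
  bump zero    c x zero    = c + x zero
  bump zero    c x (suc j) = x (suc j)
  bump (suc i) c x zero    = x zero
  bump (suc i) c x (suc j) = bump i c (x ∘ suc) j

  sumᴿ-bump : ∀ {m} i c (a x : Fin m → Carrier R) →
    sumᴿ R m (λ j → a j * bump i c x j) ≡ c * a i + sumᴿ R m (λ j → a j * x j)
  sumᴿ-bump {suc m} zero c a x = begin
    a zero * (c + x zero) + rest            ≡⟨ ≡.cong (_+ rest) (distribˡ (a zero) c (x zero)) ⟩
    a zero * c + a zero * x zero + rest     ≡⟨ +-assoc _ _ _ ⟩
    a zero * c + (a zero * x zero + rest)   ≡⟨ +-congʳ (*-comm (a zero) c) ⟩
    c * a zero + (a zero * x zero + rest)   ∎
    where rest = sumᴿ R m (λ j → a (suc j) * x (suc j))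
  sumᴿ-bump {suc m} (suc i) c a x = begin
    a zero * x zero + sumᴿ R m (λ j → a (suc j) * bump i c (x ∘ suc) j)
      ≡⟨ ≡.cong (a zero * x zero +_) (sumᴿ-bump i c (a ∘ suc) (x ∘ suc)) ⟩
    a zero * x zero + (c * a (suc i) + rest)  ≡⟨ +-assoc _ _ _ ⟨
    a zero * x zero + c * a (suc i) + rest    ≡⟨ ≡.cong (_+ rest) (+-comm _ _) ⟩
    c * a (suc i) + a zero * x zero + rest    ≡⟨ +-assoc _ _ _ ⟩
    c * a (suc i) + (a zero * x zero + rest)  ∎
    where rest = sumᴿ R m (λ j → a (suc j) * x (suc j))

  span⇒solvable : ∀ {m} {A : Fin m → Fin m → Carrier R} {b} → InSpan A b → Solvable R m A b
  span⇒solvable {m} {A} (nil b≡0) = (λ _ → 0#) , λ i → ≡.trans (sumᴿ-zero m (λ j → zeroʳ (A i j))) (sym (b≡0 i))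
  span⇒solvable {m} {A} (cons j c s e) with span⇒solvable s
  ... | x , Ax≡b = bump j c x , λ i → ≡.trans (sumᴿ-bump j c (A i) x) (≡.trans (≡.cong (c * A i j +_) (Ax≡b i)) (sym (e i)))

  solvable⇒span : ∀ {m} {A : Fin m → Fin m → Carrier R} {b} → Solvable R m A b → InSpan A b
  solvable⇒span {m} {A} (x , Ax≡b) = span-resp Ax≡b (span-sumᴿ m A x)

  module _ {n d} (D : IData R n d) (wd : WellDef R D) where
    open IData D

    private
      Tuple = Vec (Fin n) d

      Eqv-refl : ∀ {y} → Dom y → Eqv y y
      Eqv-refl p = proj₁ wd _ p

      Eqv-sym : ∀ {y z} → Dom y → Dom z → Eqv y z → Eqv z y
      Eqv-sym = proj₁ (proj₂ wd) _ _

      Eqv-trans : ∀ {y z w} → Dom y → Dom z → Dom w → Eqv y z → Eqv z w → Eqv y w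
      Eqv-trans = proj₁ (proj₂ (proj₂ wd)) _ _ _

      Rel-resp₁ : ∀ {r y y′} → Dom y → Dom y′ → Eqv y y′ → Rel (inj₂ r) (y ∷ []) → Rel (inj₂ r) (y′ ∷ [])
      Rel-resp₁ p p′ e = proj₂ (proj₂ (proj₂ wd)) _ (_ ∷ []) (_ ∷ [])
        (λ { zero → p }) (λ { zero → p′ }) (λ { zero → e })

      Rel-resp₂ : ∀ {r y z y′ z′} → Dom y → Dom z → Dom y′ → Dom z′ → Eqv y y′ → Eqv z z′ →
        Rel (inj₁ r) (y ∷ z ∷ []) → Rel (inj₁ r) (y′ ∷ z′ ∷ [])
      Rel-resp₂ p q p′ q′ e f = proj₂ (proj₂ (proj₂ wd)) _ (_ ∷ _ ∷ []) (_ ∷ _ ∷ [])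
        (λ { zero → p ; (suc zero) → q }) (λ { zero → p′ ; (suc zero) → q′ }) (λ { zero → e ; (suc zero) → f })

    record Encoding (A : Tuple → Tuple → Carrier R) (b : Tuple → Carrier R) : Set where
      field
        encode-A : ∀ {y z} → Dom y → Dom z → ∀ r → Rel (inj₁ r) (y ∷ z ∷ []) ⇔ (A y z ≡ r)
        encode-b : ∀ {y} → Dom y → ∀ r → Rel (inj₂ r) (y ∷ []) ⇔ (b y ≡ r)
    open Encoding

    module _ {m} (Q : Quotienting R D m) where
      open Quotienting Q

      quotStruct-A : ∀ {r y z} (p : Dom y) (q : Dom z) →
        quotStruct R D Q (inj₁ r) (cls y p ∷ cls z q ∷ []) ⇔ Rel (inj₁ r) (y ∷ z ∷ [])
      quotStruct-A p q = mk⇔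
        (λ { (y ∷ z ∷ [] , ps , es , h) → Rel-resp₂ (ps zero) (ps (suc zero)) p q
               (to (cls-ker _ _ _ _) (es zero)) (to (cls-ker _ _ _ _) (es (suc zero))) h })
        (λ h → _ ∷ _ ∷ [] , (λ { zero → p ; (suc zero) → q }) , (λ { zero → ≡.refl ; (suc zero) → ≡.refl }) , h)

      quotStruct-b : ∀ {r y} (p : Dom y) →
        quotStruct R D Q (inj₂ r) (cls y p ∷ []) ⇔ Rel (inj₂ r) (y ∷ [])
      quotStruct-b p = mk⇔
        (λ { (y ∷ [] , ps , es , h) → Rel-resp₁ (ps zero) p (to (cls-ker _ _ _ _) (es zero)) h })
        (λ h → _ ∷ [] , (λ { zero → p }) , (λ { zero → ≡.refl }) , h)

      module _ {A : Fin m → Fin m → Carrier R} {b : Fin m → Carrier R} (enc : Encodes R (quotStruct R D Q) A b) where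

        Rel-A : ∀ {y z} (p : Dom y) (q : Dom z) r → Rel (inj₁ r) (y ∷ z ∷ []) ⇔ (A (cls y p) (cls z q) ≡ r)
        Rel-A p q r = mk⇔ (to (proj₁ enc _ _ r) ∘ from (quotStruct-A p q)) (to (quotStruct-A p q) ∘ from (proj₁ enc _ _ r))

        Rel-b : ∀ {y} (p : Dom y) r → Rel (inj₂ r) (y ∷ []) ⇔ (b (cls y p) ≡ r)
        Rel-b p r = mk⇔ (to (proj₂ enc _ r) ∘ from (quotStruct-b p)) (to (quotStruct-b p) ∘ from (proj₂ enc _ r))

    solve⇒functional-A : IInSolve R D → ∀ {y z} → Dom y → Dom z → ∃ λ a → ∀ r → Rel (inj₁ r) (y ∷ z ∷ []) ⇔ (a ≡ r)
    solve⇒functional-A (m , Q , A , b , enc , _) p q = _ , Rel-A Q enc p q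

    solve⇒functional-b : IInSolve R D → ∀ {y} → Dom y → ∃ λ a → ∀ r → Rel (inj₂ r) (y ∷ []) ⇔ (a ≡ r)
    solve⇒functional-b (m , Q , A , b , enc , _) p = _ , Rel-b Q enc p

    SpanOnDom : (Tuple → Tuple → Carrier R) → (Tuple → Carrier R) → Set
    SpanOnDom A b = InSpan {Σ Tuple Dom} {Σ Tuple Dom} (λ (y , _) (z , _) → A y z) (λ (y , _) → b y)

    module _ {A : Tuple → Tuple → Carrier R} {b : Tuple → Carrier R} (E : Encoding A b) where

      solve⇒span : IInSolve R D → SpanOnDom A b
      solve⇒span (m , Q , A′ , b′ , enc , sol) = span-resp (λ (y , p) → sym (b≡ p))
        (span-pull (λ (y , p) → cls y p) column (solvable⇒span sol))
        where
        open Quotienting Q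

        A≡ : ∀ {y z} (p : Dom y) (q : Dom z) → A y z ≡ A′ (cls y p) (cls z q)
        A≡ p q = to (encode-A E p q _) (from (Rel-A Q enc p q _) ≡.refl)

        b≡ : ∀ {y} (p : Dom y) → b y ≡ b′ (cls y p)
        b≡ p = to (encode-b E p _) (from (Rel-b Q enc p _) ≡.refl)

        column : ∀ u → InSpan (λ (y , _) (z , _) → A y z) (λ (y , p) → A′ (cls y p) u)
        column u with cls-surj u
        ... | z , q , ≡.refl = span-resp (λ (y , p) → A≡ p q) (span-gen (z , q))

      -- A transversal of the equivalence on the listed tuples. Taken for the list of all tuples, it
      -- provides the enumerated quotient that `IInSolve` asks for.
      record Representatives (ys : List Tuple) : Set where
        field
          {count}  : ℕ
          rep      : Fin count → Tuple
          rep-Dom  : ∀ u → Dom (rep u)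
          separate : ∀ u v → Eqv (rep u) (rep v) → u ≡ v
          cover    : ∀ {y} → y ∈ ys → Dom y → ∃ λ u → Eqv y (rep u)

      module _ (Dom? : ∀ y → Dec (Dom y)) (Eqv? : ∀ y z → Dec (Eqv y z)) where

        representatives : ∀ ys → Representatives ys
        representatives [] = record { count = 0 ; rep = λ () ; rep-Dom = λ () ; separate = λ () ; cover = λ () }
        representatives (y ∷ ys) with representatives ys
        ... | record { rep = rep ; rep-Dom = rep-Dom ; separate = separate ; cover = cover }
          with Dom? y
        ... | no ¬p = record
          { rep = rep ; rep-Dom = rep-Dom ; separate = separate
          ; cover = λ { (here ≡.refl) p → contradiction p ¬p ; (there y∈) → cover y∈ } }
        ... | yes p with Fin.any? (λ u → Eqv? y (rep u))
        ...   | yes hit = record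
          { rep = rep ; rep-Dom = rep-Dom ; separate = separate
          ; cover = λ { (here ≡.refl) _ → hit ; (there y∈) → cover y∈ } }
        ...   | no miss = record
          { rep      = λ { zero → y ; (suc u) → rep u }
          ; rep-Dom  = λ { zero → p ; (suc u) → rep-Dom u }
          ; separate = λ { zero zero _ → ≡.refl
                         ; zero (suc v) e → contradiction (v , e) miss
                         ; (suc u) zero e → contradiction (u , Eqv-sym (rep-Dom u) p e) miss
                         ; (suc u) (suc v) e → ≡.cong suc (separate u v e) }
          ; cover    = λ { (here ≡.refl) _ → zero , Eqv-refl p
                         ; (there y∈) q → let u , e = cover y∈ q in suc u , e } }

        open Representatives (representatives (vectors n d))

        private
          class : ∀ y → Dom y → Fin count
          class y p = proj₁ (cover (∈-vectors y) p)

          to-rep : ∀ {y} (p : Dom y) → Eqv y (rep (class y p))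
          to-rep {y} p = proj₂ (cover (∈-vectors y) p)

          class-rep : ∀ u → class (rep u) (rep-Dom u) ≡ u
          class-rep u = ≡.sym (separate u _ (to-rep (rep-Dom u)))

          Q : Quotienting R D count
          Q = record
            { cls      = class
            ; cls-surj = λ u → rep u , rep-Dom u , class-rep u
            ; cls-ker  = λ y z p q → mk⇔
                (λ e → Eqv-trans p (rep-Dom _) q (to-rep p)
                  (Eqv-sym q (rep-Dom _) (≡.subst (λ u → Eqv z (rep u)) (≡.sym e) (to-rep q))))
                (λ e → separate _ _ (Eqv-trans (rep-Dom _) p (rep-Dom _) (Eqv-sym p (rep-Dom _) (to-rep p))
                  (Eqv-trans p q (rep-Dom _) e (to-rep q))))
            }

          A′ : Fin count → Fin count → Carrier R
          A′ u v = A (rep u) (rep v)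

          b′ : Fin count → Carrier R
          b′ u = b (rep u)

          encodes : Encodes R (quotStruct R D Q) A′ b′
          encodes =
            (λ u v r → ≡.subst₂ (λ u′ v′ → quotStruct R D Q (inj₁ r) (u′ ∷ v′ ∷ []) ⇔ (A′ u v ≡ r))
              (class-rep u) (class-rep v)
              (mk⇔ (to (encode-A E (rep-Dom u) (rep-Dom v) r) ∘ to (quotStruct-A Q (rep-Dom u) (rep-Dom v)))
                   (from (quotStruct-A Q (rep-Dom u) (rep-Dom v)) ∘ from (encode-A E (rep-Dom u) (rep-Dom v) r)))) ,
            (λ u r → ≡.subst (λ u′ → quotStruct R D Q (inj₂ r) (u′ ∷ []) ⇔ (b′ u ≡ r)) (class-rep u)
              (mk⇔ (to (encode-b E (rep-Dom u) r) ∘ to (quotStruct-b Q (rep-Dom u)))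
                   (from (quotStruct-b Q (rep-Dom u)) ∘ from (encode-b E (rep-Dom u) r))))

          -- `z` may differ from its representative, but by well-definedness both have the same
          -- column.
          column : ∀ z → Dom z → InSpan A′ (λ u → A (rep u) z)
          column z q = span-resp (λ u → sym (to (encode-A E (rep-Dom u) q _)
              (Rel-resp₂ (rep-Dom u) (rep-Dom v) (rep-Dom u) q (Eqv-refl (rep-Dom u)) (Eqv-sym q (rep-Dom v) (to-rep q))
                (from (encode-A E (rep-Dom u) (rep-Dom v) _) ≡.refl))))
            (span-gen v)
            where v = class z q

        span⇒solve : SpanOnDom A b → IInSolve R D
        span⇒solve s = count , Q , A′ , b′ , encodes ,
          span⇒solvable (span-pull (λ u → rep u , rep-Dom u) (λ (z , q) → column z q) s)

-- Definability

module _ (R : FinCommRing) where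

  module _ {n d} {D D′ : IData R n d} where
    private
      module D  = IData D
      module D′ = IData D′

    module _ (Dom⇔ : ∀ y → D.Dom y ⇔ D′.Dom y) (Eqv⇔ : ∀ y z → D.Eqv y z ⇔ D′.Eqv y z)
      (Rel⇔ : ∀ s ys → D.Rel s ys ⇔ D′.Rel s ys) where

      wellDef-cong : WellDef R D → WellDef R D′
      wellDef-cong (rfl , sm , trn , cong) =
        (λ y p → to (Eqv⇔ _ _) (rfl y (from (Dom⇔ _) p))) ,
        (λ y z p q e → to (Eqv⇔ _ _) (sm y z (from (Dom⇔ _) p) (from (Dom⇔ _) q) (from (Eqv⇔ _ _) e))) ,
        (λ y z w p q r e f → to (Eqv⇔ _ _) (trn y z w (from (Dom⇔ _) p) (from (Dom⇔ _) q) (from (Dom⇔ _) r)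
          (from (Eqv⇔ _ _) e) (from (Eqv⇔ _ _) f))) ,
        (λ s ys zs ps qs es h → to (Rel⇔ _ _) (cong s ys zs (λ i → from (Dom⇔ _) (ps i)) (λ i → from (Dom⇔ _) (qs i))
          (λ i → from (Eqv⇔ _ _) (es i)) (from (Rel⇔ _ _) h)))

      iInSolve-cong : IInSolve R D → IInSolve R D′
      iInSolve-cong (m , Q , A , b , (encA , encb) , sol) = m , Q′ , A , b ,
        ((λ i j r → ⇔-trans (quotient⇔ (inj₁ r) (i ∷ j ∷ [])) (encA i j r)) ,
         (λ i r → ⇔-trans (quotient⇔ (inj₂ r) (i ∷ [])) (encb i r))) , sol
        where
        open Quotienting Q

        -- `cls` takes a proof of membership, and the round trip through `Dom⇔` may return a
        -- different proof.
        cls-irrelevant : ∀ {y} (p q : D.Dom y) → cls y p ≡ cls y q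
        cls-irrelevant p q = from (cls-ker _ _ p q) (to (cls-ker _ _ p p) ≡.refl)

        Q′ : Quotienting R D′ m
        Q′ = record
          { cls      = λ y p → cls y (from (Dom⇔ y) p)
          ; cls-surj = λ u → let y , p , e = cls-surj u in y , to (Dom⇔ y) p , ≡.trans (cls-irrelevant _ _) e
          ; cls-ker  = λ y z p q → ⇔-trans (cls-ker y z _ _) (Eqv⇔ y z)
          }

        quotient⇔ : ∀ s us → quotStruct R D′ Q′ s us ⇔ quotStruct R D Q s us
        quotient⇔ s us = mk⇔
          (λ (ys , ps , es , h) → ys , (λ i → from (Dom⇔ _) (ps i)) , es , from (Rel⇔ _ _) h)
          (λ (ys , ps , es , h) → ys , (λ i → to (Dom⇔ _) (ps i)) ,
            (λ i → ≡.trans (cls-irrelevant _ _) (es i)) , to (Rel⇔ _ _) h)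

  rename : ∀ {σ V W} → (V → W) → Formula R σ V → Formula R σ W
  rename f (rel s xs)       = rel s (Vec.map f xs)
  rename f (eq x y)         = eq (f x) (f y)
  rename f tt               = tt
  rename f (neg φ)          = neg (rename f φ)
  rename f (and φ ψ)        = and (rename f φ) (rename f ψ)
  rename f (or φ ψ)         = or (rename f φ) (rename f ψ)
  rename f (ex φ)           = ex (rename (Maybe.map f) φ)
  rename f (all φ)          = all (rename (Maybe.map f) φ)
  rename f (solveQ d δ ε φ) =
    solveQ d (rename (Sum.map₁ f) δ) (rename (Sum.map₁ f) ε) (λ s → rename (Sum.map₁ f) (φ s))

  ×-⇔ : ∀ {A B C D : Set} → A ⇔ C → B ⇔ D → (A × B) ⇔ (C × D)
  ×-⇔ e f = mk⇔ (Prod.map (to e) (to f)) (Prod.map (from e) (from f))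

  ⊎-⇔ : ∀ {A B C D : Set} → A ⇔ C → B ⇔ D → (A ⊎ B) ⇔ (C ⊎ D)
  ⊎-⇔ e f = mk⇔ (Sum.map (to e) (to f)) (Sum.map (from e) (from f))

  ¬-⇔ : ∀ {A B : Set} → A ⇔ B → (¬ A) ⇔ (¬ B)
  ¬-⇔ e = mk⇔ (_∘ from e) (_∘ to e)

  sat-rename : ∀ {σ V W n} (𝒜 : Struct σ n) (φ : Formula R σ V) {f : V → W} {ρ : V → Fin n} {ρ′ : W → Fin n} →
    (∀ v → ρ′ (f v) ≡ ρ v) → Sat R 𝒜 (rename f φ) ρ′ ⇔ Sat R 𝒜 φ ρ
  sat-rename 𝒜 (rel s xs) {f} {ρ} {ρ′} e =
    ≡.subst (λ ys → T (𝒜 s (Vec.map ρ′ (Vec.map f xs))) ⇔ T (𝒜 s ys))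
      (≡.trans (≡.sym (Vec.map-∘ ρ′ f xs)) (Vec.map-cong e xs)) ⇔-refl
  sat-rename 𝒜 (eq x y) e =
    mk⇔ (λ h → ≡.trans (≡.sym (e x)) (≡.trans h (e y))) (λ h → ≡.trans (e x) (≡.trans h (≡.sym (e y))))
  sat-rename 𝒜 tt        e = ⇔-refl
  sat-rename 𝒜 (neg φ)   e = ¬-⇔ (sat-rename 𝒜 φ e)
  sat-rename 𝒜 (and φ ψ) e = ×-⇔ (sat-rename 𝒜 φ e) (sat-rename 𝒜 ψ e)
  sat-rename 𝒜 (or φ ψ)  e = ⊎-⇔ (sat-rename 𝒜 φ e) (sat-rename 𝒜 ψ e)
  sat-rename 𝒜 (ex φ) {f} {ρ} {ρ′} e = mk⇔ (map₂ (λ {a} → to (body a))) (map₂ (λ {a} → from (body a)))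
    where
    body : ∀ a → Sat R 𝒜 (rename (Maybe.map f) φ) (maybe′ ρ′ a) ⇔ Sat R 𝒜 φ (maybe′ ρ a)
    body a = sat-rename 𝒜 φ (λ { (just v) → e v ; nothing → ≡.refl })
  sat-rename 𝒜 (all φ) {f} {ρ} {ρ′} e = mk⇔ (λ h a → to (body a) (h a)) (λ h a → from (body a) (h a))
    where
    body : ∀ a → Sat R 𝒜 (rename (Maybe.map f) φ) (maybe′ ρ′ a) ⇔ Sat R 𝒜 φ (maybe′ ρ a)
    body a = sat-rename 𝒜 φ (λ { (just v) → e v ; nothing → ≡.refl })
  sat-rename 𝒜 (solveQ d δ ε φ) {f} {ρ} {ρ′} e = mk⇔
    (Prod.map (wellDef-cong δ⇔ ε⇔ φ⇔) (iInSolve-cong δ⇔ ε⇔ φ⇔))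
    (Prod.map (wellDef-cong (λ y → ⇔-sym (δ⇔ y)) (λ y z → ⇔-sym (ε⇔ y z)) (λ s ys → ⇔-sym (φ⇔ s ys)))
              (iInSolve-cong (λ y → ⇔-sym (δ⇔ y)) (λ y z → ⇔-sym (ε⇔ y z)) (λ s ys → ⇔-sym (φ⇔ s ys))))
    where
    extend : ∀ {B : Set} (g : B → Fin _) v → [ ρ′ , g ] (Sum.map₁ f v) ≡ [ ρ , g ] v
    extend g (inj₁ v) = e v
    extend g (inj₂ b) = ≡.refl

    δ⇔ : ∀ y → Sat R 𝒜 (rename (Sum.map₁ f) δ) [ ρ′ , lookup y ] ⇔ Sat R 𝒜 δ [ ρ , lookup y ]
    δ⇔ y = sat-rename 𝒜 δ (extend (lookup y))

    ε⇔ : ∀ y z → Sat R 𝒜 (rename (Sum.map₁ f) ε) [ ρ′ , pick R (y ∷ z ∷ []) ] ⇔ Sat R 𝒜 ε [ ρ , pick R (y ∷ z ∷ []) ]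
    ε⇔ y z = sat-rename 𝒜 ε (extend (pick R (y ∷ z ∷ [])))

    φ⇔ : ∀ s ys → Sat R 𝒜 (rename (Sum.map₁ f) (φ s)) [ ρ′ , pick R ys ] ⇔ Sat R 𝒜 (φ s) [ ρ , pick R ys ]
    φ⇔ s ys = sat-rename 𝒜 (φ s) (extend (pick R ys))

  -- What the constructions need from a logic, so that quantifier-free and first-order
  -- interpretations are treated at once. `decide` permits case distinctions on the truth of
  -- formulas, from which the ring elements encoded by a structure are computed.
  record Fragment (σ : Signature) : Set₁ where
    field
      P        : ∀ {V} → Formula R σ V → Set
      P-eq     : ∀ {V} (x y : V) → P (eq x y)
      P-tt     : ∀ {V} → P (tt {V = V})
      P-neg    : ∀ {V} {φ : Formula R σ V} → P φ → P (neg φ)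
      P-and    : ∀ {V} {φ ψ : Formula R σ V} → P φ → P ψ → P (and φ ψ)
      P-or     : ∀ {V} {φ ψ : Formula R σ V} → P φ → P ψ → P (or φ ψ)
      P-rename : ∀ {V W} (f : V → W) {φ : Formula R σ V} → P φ → P (rename f φ)
      decide   : ∀ {V} {φ : Formula R σ V} → P φ → ∀ {n} (𝒜 : Struct σ n) ρ → Dec (Sat R 𝒜 φ ρ)

  isQF-rename : ∀ {σ V W} (f : V → W) (φ : Formula R σ V) → IsQF R φ → IsQF R (rename f φ)
  isQF-rename f (rel s xs) q       = tt
  isQF-rename f (eq x y)   q       = tt
  isQF-rename f tt         q       = tt
  isQF-rename f (neg φ)    q       = isQF-rename f φ q
  isQF-rename f (and φ ψ)  (q , r) = isQF-rename f φ q , isQF-rename f ψ r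
  isQF-rename f (or φ ψ)   (q , r) = isQF-rename f φ q , isQF-rename f ψ r

  isFO-rename : ∀ {σ V W} (f : V → W) (φ : Formula R σ V) → IsFO R φ → IsFO R (rename f φ)
  isFO-rename f (rel s xs) q       = tt
  isFO-rename f (eq x y)   q       = tt
  isFO-rename f tt         q       = tt
  isFO-rename f (neg φ)    q       = isFO-rename f φ q
  isFO-rename f (and φ ψ)  (q , r) = isFO-rename f φ q , isFO-rename f ψ r
  isFO-rename f (or φ ψ)   (q , r) = isFO-rename f φ q , isFO-rename f ψ r
  isFO-rename f (ex φ)     q       = isFO-rename (Maybe.map f) φ q
  isFO-rename f (all φ)    q       = isFO-rename (Maybe.map f) φ q

  isQF⇒isFO : ∀ {σ V} (φ : Formula R σ V) → IsQF R φ → IsFO R φ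
  isQF⇒isFO (rel s xs) q       = tt
  isQF⇒isFO (eq x y)   q       = tt
  isQF⇒isFO tt         q       = tt
  isQF⇒isFO (neg φ)    q       = isQF⇒isFO φ q
  isQF⇒isFO (and φ ψ)  (q , r) = isQF⇒isFO φ q , isQF⇒isFO ψ r
  isQF⇒isFO (or φ ψ)   (q , r) = isQF⇒isFO φ q , isQF⇒isFO ψ r

  fo-decide : ∀ {σ V n} (φ : Formula R σ V) → IsFO R φ → (𝒜 : Struct σ n) → ∀ ρ → Dec (Sat R 𝒜 φ ρ)
  fo-decide (rel s xs) q       𝒜 ρ = T? (𝒜 s (Vec.map ρ xs))
  fo-decide (eq x y)   q       𝒜 ρ = ρ x Fin.≟ ρ y
  fo-decide tt         q       𝒜 ρ = yes tt
  fo-decide (neg φ)    q       𝒜 ρ = ¬? (fo-decide φ q 𝒜 ρ)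
  fo-decide (and φ ψ)  (q , r) 𝒜 ρ = fo-decide φ q 𝒜 ρ ×-dec fo-decide ψ r 𝒜 ρ
  fo-decide (or φ ψ)   (q , r) 𝒜 ρ = fo-decide φ q 𝒜 ρ ⊎-dec fo-decide ψ r 𝒜 ρ
  fo-decide (ex φ)     q       𝒜 ρ = Fin.any? (λ a → fo-decide φ q 𝒜 (maybe′ ρ a))
  fo-decide (all φ)    q       𝒜 ρ = Fin.all? (λ a → fo-decide φ q 𝒜 (maybe′ ρ a))

  quantifierFree firstOrder : ∀ σ → Fragment σ
  quantifierFree σ = record
    { P = λ φ → IsQF R φ ; P-eq = λ _ _ → tt ; P-tt = tt ; P-neg = id ; P-and = _,_ ; P-or = _,_
    ; P-rename = λ f {φ} → isQF-rename f φ ; decide = λ {_} {φ} q → fo-decide φ (isQF⇒isFO φ q) }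
  firstOrder σ = record
    { P = λ φ → IsFO R φ ; P-eq = λ _ _ → tt ; P-tt = tt ; P-neg = id ; P-and = _,_ ; P-or = _,_
    ; P-rename = λ f {φ} → isFO-rename f φ ; decide = λ {_} {φ} q → fo-decide φ q }

does-true : ∀ {Q : Set} (Q? : Dec Q) → does Q? ≡ true → Q
does-true (yes q) _ = q

does-false : ∀ {Q : Set} (Q? : Dec Q) → does Q? ≡ false → ¬ Q
does-false (no ¬q) _ = ¬q

-- Tuple shapes and definable functions on them

infixr 5 _⊗_
-- Index sets of composite systems keep their product structure and are flattened to plain vectors
-- only when an interpretation is produced.
data Code : Set where
  tup : ℕ → Code
  _⊗_ : Code → Code → Code

Var : Code → Set
Var (tup d)  = Fin d
Var (c ⊗ c′) = Var c ⊎ Var c′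

Tup : Code → ℕ → Set
Tup (tup d)  n = Vec (Fin n) d
Tup (c ⊗ c′) n = Tup c n × Tup c′ n

get : ∀ c {n} → Tup c n → Var c → Fin n
get (tup d)  x       = lookup x
get (c ⊗ c′) (x , y) = [ get c x , get c′ y ]

tuples : ∀ c n → List (Tup c n)
tuples (tup d)  n = vectors n d
tuples (c ⊗ c′) n = cartesianProduct (tuples c n) (tuples c′ n)

∈-tuples : ∀ c {n} (x : Tup c n) → x ∈ tuples c n
∈-tuples (tup d)  x       = ∈-vectors x
∈-tuples (c ⊗ c′) (x , y) = ∈-cartesianProduct⁺ (∈-tuples c x) (∈-tuples c′ y)

constant : ∀ c {n} → Fin n → Tup c n
constant (tup d)  a = replicate d a
constant (c ⊗ c′) a = constant c a , constant c′ a

constant-unique : ∀ c (x : Tup c 1) → x ≡ constant c zero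
constant-unique (tup zero)    []         = ≡.refl
constant-unique (tup (suc d)) (zero ∷ x) = ≡.cong (zero ∷_) (constant-unique (tup d) x)
constant-unique (c ⊗ c′)      (x , y)    = ≡.cong₂ _,_ (constant-unique c x) (constant-unique c′ y)

infix 4 _≟ᵗ_
_≟ᵗ_ : ∀ {c n} → DecidableEquality (Tup c n)
_≟ᵗ_ {tup d}  = Vec.≡-dec Fin._≟_
_≟ᵗ_ {c ⊗ c′} = ×-≡-dec (_≟ᵗ_ {c}) (_≟ᵗ_ {c′})

-- A map of tuples that merely rearranges entries, together with its contravariant action on
-- variables. Naturality makes renaming a formula by `var` express precomposition with `map`.
record Sub (c d : Code) : Set where
  field
    map     : ∀ {n} → Tup c n → Tup d n
    var     : Var d → Var c
    natural : ∀ {n} (x : Tup c n) v → get c x (var v) ≡ get d (map x) v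
open Sub

infixr 4 ⟨_,_⟩
infixr 9 _⊙_

idˢ : ∀ {c} → Sub c c
idˢ = record { map = id ; var = id ; natural = λ _ _ → ≡.refl }

_⊙_ : ∀ {c d e} → Sub d e → Sub c d → Sub c e
t ⊙ s = record
  { map = map t ∘ map s ; var = var s ∘ var t
  ; natural = λ x v → ≡.trans (natural s x (var t v)) (natural t (map s x) v) }

π₁ : ∀ {c d} → Sub (c ⊗ d) c
π₁ = record { map = proj₁ ; var = inj₁ ; natural = λ _ _ → ≡.refl }

π₂ : ∀ {c d} → Sub (c ⊗ d) d
π₂ = record { map = proj₂ ; var = inj₂ ; natural = λ _ _ → ≡.refl }

⟨_,_⟩ : ∀ {c d e} → Sub c d → Sub c e → Sub c (d ⊗ e)
⟨ s , t ⟩ = record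
  { map = < map s , map t > ; var = [ var s , var t ]
  ; natural = λ { x (inj₁ v) → natural s x v ; x (inj₂ v) → natural t x v } }

constantˢ : ∀ c → Sub (tup 1) c
constantˢ c = record
  { map = λ x → constant c (lookup x zero) ; var = λ _ → zero ; natural = λ x v → ≡.sym (get-constant c v) }
  where
  get-constant : ∀ c {n} {a : Fin n} v → get c (constant c a) v ≡ a
  get-constant (tup d)  {a = a} v = Vec.lookup-replicate v a
  get-constant (c ⊗ c′) (inj₁ v)  = get-constant c v
  get-constant (c ⊗ c′) (inj₂ v)  = get-constant c′ v

consˢ : ∀ {j} → Sub (tup 1 ⊗ tup j) (tup (suc j))
consˢ = record
  { map     = λ (x , y) → lookup x zero ∷ y
  ; var     = λ { zero → inj₁ zero ; (suc i) → inj₂ i }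
  ; natural = λ { x zero → ≡.refl ; x (suc i) → ≡.refl }
  }

module Definability (R : FinCommRing) {σ : Signature} (𝓛 : Fragment R σ) where
  open Fragment 𝓛

  Fn : Code → Set → Set
  Fn c X = ∀ n → Struct σ (suc n) → Tup c (suc n) → X

  -- A function is given by formulas for its fibres. In particular, a definable truth value comes
  -- with a formula for its failure, which is what `def-if` needs.
  Definable : ∀ c {X} → Fn c X → Set₁
  Definable c F = ∀ x → Σ (Formula R σ (Var c)) λ φ → P φ ×
    (∀ n (𝒜 : Struct σ (suc n)) v → Sat R 𝒜 φ (get c v) ⇔ (F n 𝒜 v ≡ x))

  module _ {c : Code} where

    def-decidable : ∀ (φ : Formula R σ (Var c)) → P φ → {Q : ∀ n → Struct σ (suc n) → Tup c (suc n) → Set} →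
      (∀ n (𝒜 : Struct σ (suc n)) v → Sat R 𝒜 φ (get c v) ⇔ Q n 𝒜 v) →
      (Q? : ∀ n 𝒜 v → Dec (Q n 𝒜 v)) → Definable c (λ n 𝒜 v → does (Q? n 𝒜 v))
    def-decidable φ Pφ φ⇔Q Q? true = φ , Pφ , λ n 𝒜 v → ⇔-trans (φ⇔Q n 𝒜 v)
      (mk⇔ (dec-true (Q? n 𝒜 v)) (does-true (Q? n 𝒜 v)))
    def-decidable φ Pφ φ⇔Q Q? false = neg φ , P-neg Pφ , λ n 𝒜 v → mk⇔
      (λ ¬s → dec-false (Q? n 𝒜 v) (¬s ∘ from (φ⇔Q n 𝒜 v)))
      (λ e s → does-false (Q? n 𝒜 v) e (to (φ⇔Q n 𝒜 v) s))

    def-const : ∀ {X} → DecidableEquality X → (x : X) → Definable c (λ _ _ _ → x)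
    def-const _≟_ x y with x ≟ y
    ... | yes x≡y = tt , P-tt , λ _ _ _ → mk⇔ (λ _ → x≡y) (λ _ → tt)
    ... | no  x≢y = neg tt , P-neg P-tt , λ _ _ _ → mk⇔ (λ ¬t → contradiction tt ¬t) (λ e _ → x≢y e)

    def-if : ∀ {X} {B : Fn c Bool} {F G : Fn c X} → Definable c B → Definable c F → Definable c G →
      Definable c (λ n 𝒜 v → if B n 𝒜 v then F n 𝒜 v else G n 𝒜 v)
    def-if {B = B} {F} {G} dB dF dG x =
      let β , Pβ , β⇔ = dB true ; β′ , Pβ′ , β′⇔ = dB false ; φ , Pφ , φ⇔ = dF x ; ψ , Pψ , ψ⇔ = dG x
      in or (and β φ) (and β′ ψ) , P-or (P-and Pβ Pφ) (P-and Pβ′ Pψ) , λ n 𝒜 v → ⇔-trans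
        (⊎-⇔ R (×-⇔ R (β⇔ n 𝒜 v) (φ⇔ n 𝒜 v)) (×-⇔ R (β′⇔ n 𝒜 v) (ψ⇔ n 𝒜 v)))
        (if⇔ (B n 𝒜 v))
      where
      if⇔ : ∀ b {f g} → ((b ≡ true × f ≡ x) ⊎ (b ≡ false × g ≡ x)) ⇔ ((if b then f else g) ≡ x)
      if⇔ true  = mk⇔ (λ { (inj₁ (_ , e)) → e ; (inj₂ (() , _)) }) (λ e → inj₁ (≡.refl , e))
      if⇔ false = mk⇔ (λ { (inj₁ (() , _)) ; (inj₂ (_ , e)) → e }) (λ e → inj₂ (≡.refl , e))

    disjunction : ∀ k → (Fin k → Formula R σ (Var c)) → Formula R σ (Var c)
    disjunction zero    φ = neg tt
    disjunction (suc k) φ = or (φ zero) (disjunction k (φ ∘ suc))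

    P-disjunction : ∀ k {φ : Fin k → Formula R σ (Var c)} → (∀ u → P (φ u)) → P (disjunction k φ)
    P-disjunction zero    Pφ = P-neg P-tt
    P-disjunction (suc k) Pφ = P-or (Pφ zero) (P-disjunction k (Pφ ∘ suc))

    sat-disjunction : ∀ k {φ : Fin k → Formula R σ (Var c)} {n} {𝒜 : Struct σ n} {ρ} →
      Sat R 𝒜 (disjunction k φ) ρ ⇔ ∃ λ u → Sat R 𝒜 (φ u) ρ
    sat-disjunction zero = mk⇔ (λ ¬t → contradiction tt ¬t) (λ ())
    sat-disjunction (suc k) {φ} = mk⇔
      (λ { (inj₁ s) → zero , s ; (inj₂ s) → let u , t = to (sat-disjunction k {φ ∘ suc}) s in suc u , t })
      (λ { (zero , s) → inj₁ s ; (suc u , s) → inj₂ (from (sat-disjunction k {φ ∘ suc}) (u , s)) })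

    -- The intermediate value ranges over a finite set, so it can be guessed by a disjunction
    -- instead of a quantifier.
    def-bind : ∀ {k X} {F : Fn c (Fin k)} {G : Fin k → Fn c X} → Definable c F → (∀ u → Definable c (G u)) →
      Definable c (λ n 𝒜 v → G (F n 𝒜 v) n 𝒜 v)
    def-bind {k} {F = F} {G} dF dG x =
      disjunction k (λ u → and (proj₁ (dF u)) (proj₁ (dG u x))) ,
      P-disjunction k (λ u → P-and (proj₁ (proj₂ (dF u))) (proj₁ (proj₂ (dG u x)))) ,
      λ n 𝒜 v → ⇔-trans (sat-disjunction k) (mk⇔
        (λ (u , s , t) → ≡.trans (≡.cong (λ u → G u n 𝒜 v) (to (proj₂ (proj₂ (dF u)) n 𝒜 v) s))
                                 (to (proj₂ (proj₂ (dG u x)) n 𝒜 v) t))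
        (λ e → F n 𝒜 v , from (proj₂ (proj₂ (dF _)) n 𝒜 v) ≡.refl , from (proj₂ (proj₂ (dG _ x)) n 𝒜 v) e))

    def-map : ∀ {k X} → DecidableEquality X → {F : Fn c (Fin k)} (g : Fin k → X) → Definable c F →
      Definable c (λ n 𝒜 v → g (F n 𝒜 v))
    def-map _≟_ g dF = def-bind dF (λ u → def-const _≟_ (g u))

    def-sub : ∀ {d X} {F : Fn d X} (s : Sub c d) → Definable d F → Definable c (λ n 𝒜 v → F n 𝒜 (map s v))
    def-sub s dF x = let φ , Pφ , φ⇔ = dF x in rename R (var s) φ , P-rename (var s) Pφ ,
      λ n 𝒜 v → ⇔-trans (sat-rename R 𝒜 φ (natural s v)) (φ⇔ n 𝒜 (map s v))

  conjunction : ∀ {V} k → (Fin k → Formula R σ V) → Formula R σ V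
  conjunction zero    φ = tt
  conjunction (suc k) φ = and (φ zero) (conjunction k (φ ∘ suc))

  equal : ∀ {V} d → (Var d → V) → (Var d → V) → Formula R σ V
  equal (tup k)  f g = conjunction k (λ i → eq (f i) (g i))
  equal (c ⊗ c′) f g = and (equal c (f ∘ inj₁) (g ∘ inj₁)) (equal c′ (f ∘ inj₂) (g ∘ inj₂))

  P-equal : ∀ {V} d {f g : Var d → V} → P (equal d f g)
  P-equal (tup zero)    = P-tt
  P-equal (tup (suc k)) = P-and (P-eq _ _) (P-equal (tup k))
  P-equal (c ⊗ c′)      = P-and (P-equal c) (P-equal c′)

  sat-equal : ∀ {V n} d {f g : Var d → V} {𝒜 : Struct σ n} {ρ} {x y : Tup d n} →
    (∀ v → ρ (f v) ≡ get d x v) → (∀ v → ρ (g v) ≡ get d y v) → Sat R 𝒜 (equal d f g) ρ ⇔ (x ≡ y)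
  sat-equal (tup zero) {x = []} {[]} e e′ = mk⇔ (λ _ → ≡.refl) (λ _ → tt)
  sat-equal (tup (suc k)) {f} {g} {𝒜} {ρ} {a ∷ x} {b ∷ y} e e′ = mk⇔
    (λ (h , t) → ≡.cong₂ _∷_ (≡.trans (≡.sym (e zero)) (≡.trans h (e′ zero))) (to tail t))
    (λ { ≡.refl → ≡.trans (e zero) (≡.sym (e′ zero)) , from tail ≡.refl })
    where
    tail : Sat R 𝒜 (equal (tup k) (f ∘ suc) (g ∘ suc)) ρ ⇔ (x ≡ y)
    tail = sat-equal (tup k) (e ∘ suc) (e′ ∘ suc)
  sat-equal (c ⊗ c′) e e′ = ⇔-trans
    (×-⇔ R (sat-equal c (e ∘ inj₁) (e′ ∘ inj₁)) (sat-equal c′ (e ∘ inj₂) (e′ ∘ inj₂)))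
    (mk⇔ (λ { (≡.refl , ≡.refl) → ≡.refl }) (λ { ≡.refl → ≡.refl , ≡.refl }))

  def-≟ : ∀ {c d} (s t : Sub c d) → Definable c (λ n 𝒜 v → does (_≟ᵗ_ {d} (map s v) (map t v)))
  def-≟ {d = d} s t = def-decidable (equal d (var s) (var t)) (P-equal d)
    (λ n 𝒜 v → sat-equal d (natural s v) (natural t v)) (λ n 𝒜 v → _≟ᵗ_ {d} (map s v) (map t v))

-- Normalising the system of an interpretation

module _ {k : ℕ} where

  search : Fin k → List (Fin k) → (Fin k → Bool) → Fin k
  search r₀ []       B = r₀
  search r₀ (r ∷ rs) B = if B r then r else search r₀ rs B

  -- `search` proposes a candidate and `agrees` confirms that it is the one and only value. Both are
  -- finite nests of conditionals and so inherit definability from `B`.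
  agrees : List (Fin k) → (Fin k → Bool) → Fin k → Bool
  agrees []       B a = true
  agrees (r ∷ rs) B a =
    if B r then (if does (a Fin.≟ r) then agrees rs B a else false)
           else (if does (a Fin.≟ r) then false else agrees rs B a)

  Values : (Fin k → Bool) → Fin k → Set
  Values B a = ∀ r → (B r ≡ true) ⇔ (a ≡ r)

  search-values : ∀ {r₀ B a rs} → Values B a → a ∈ rs → search r₀ rs B ≡ a
  search-values {B = B} {a} {rs = r ∷ rs} V a∈ with B r in e
  search-values {B = B} {a} V a∈ | true = ≡.sym (to (V _) e)
  search-values {B = B} {a} V (here ≡.refl) | false = contradiction (≡.trans (≡.sym e) (from (V _) ≡.refl)) λ ()
  search-values {B = B} {a} V (there a∈) | false = search-values V a∈

  values⇒agrees : ∀ {B a} rs → Values B a → agrees rs B a ≡ true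
  values⇒agrees [] V = ≡.refl
  values⇒agrees {B} {a} (r ∷ rs) V with B r in e | a Fin.≟ r
  ... | true  | yes _   = values⇒agrees rs V
  ... | true  | no  a≢r = contradiction (to (V r) e) a≢r
  ... | false | yes a≡r = contradiction (≡.trans (≡.sym e) (from (V r) a≡r)) λ ()
  ... | false | no  _   = values⇒agrees rs V

  agrees⇒values : ∀ {B a rs r} → agrees rs B a ≡ true → r ∈ rs → (B r ≡ true) ⇔ (a ≡ r)
  agrees⇒values {B} {a} {r ∷ rs} h r∈ with B r in e | a Fin.≟ r
  agrees⇒values h (here ≡.refl) | true  | yes a≡r = mk⇔ (λ _ → a≡r) (λ _ → e)
  agrees⇒values h (there r∈)    | true  | yes _   = agrees⇒values h r∈
  agrees⇒values h (here ≡.refl) | false | no  a≢r =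
    mk⇔ (λ t → contradiction (≡.trans (≡.sym e) t) λ ()) (λ a≡r → contradiction a≡r a≢r)
  agrees⇒values h (there r∈)    | false | no  _   = agrees⇒values h r∈

-- The system of an interpretation has a row (y , z) for every pair of tuples: it repeats the equation of y unless
-- y or (y , z) carries no unique value, in which case it reads 0 = σ₀.
module Normalise (R : FinCommRing) {σ₀ : Carrier R} (σ₀≢0 : σ₀ ≢ 0ᴿ R) {n d : ℕ}
  {D : IData R n d} (wd : WellDef R D)
  (Dom? : ∀ y → Dec (IData.Dom D y)) (Eqv? : ∀ y z → Dec (IData.Eqv D y z))
  (A? : ∀ r y z → Dec (IData.Rel D (inj₁ r) (y ∷ z ∷ []))) (b? : ∀ r y → Dec (IData.Rel D (inj₂ r) (y ∷ [])))
  where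
  open IData D
  open CommutativeRing (commRing R) hiding (zero; Carrier)
  open Span (commRing R)

  Tuple : Set
  Tuple = Vec (Fin n) d

  value-A : Tuple → Tuple → Carrier R
  value-A y z = search 0# (allFin _) (λ r → does (A? r y z))

  value-b : Tuple → Carrier R
  value-b y = search 0# (allFin _) (λ r → does (b? r y))

  good-A : Tuple → Tuple → Bool
  good-A y z = agrees (allFin _) (λ r → does (A? r y z)) (value-A y z)

  good-b : Tuple → Bool
  good-b y = agrees (allFin _) (λ r → does (b? r y)) (value-b y)

  -- That the row of `y` has an ill-defined entry somewhere is an existential statement. With `z`
  -- carried in the row index the test stays quantifier-free, and one bad pair already makes the
  -- whole system unsolvable.
  bad : Tuple → Tuple → Bool
  bad y z =
    if does (Dom? y)
      then (if good-b y then (if does (Dom? z) then (if good-A y z then false else true) else false) else true)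
      else false

  matrix : Tuple × Tuple → Tuple → Carrier R
  matrix (y , z) z′ = if bad y z then 0# else if does (Dom? y) then (if does (Dom? z′) then value-A y z′ else 0#) else 0#

  vector : Tuple × Tuple → Carrier R
  vector (y , z) = if bad y z then σ₀ else if does (Dom? y) then value-b y else 0#

  private
    GoodPair : Tuple → Tuple → Set
    GoodPair y z = Dom y → good-b y ≡ true × (Dom z → good-A y z ≡ true)

    good⇒¬bad : ∀ {y z} → GoodPair y z → bad y z ≡ false
    good⇒¬bad {y} {z} g with Dom? y
    ... | no _ = ≡.refl
    ... | yes p with good-b y | g p
    ...   | true | _ , h with Dom? z
    ...     | no _ = ≡.refl
    ...     | yes q with good-A y z | h q
    ...       | true | _ = ≡.refl

    ¬bad⇒good : ∀ {y z} → bad y z ≡ false → GoodPair y z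
    ¬bad⇒good {y} {z} e p with Dom? y
    ... | no ¬p = contradiction p ¬p
    ... | yes _ with good-b y
    ...   | true = ≡.refl , λ q → good q e
      where
      good : Dom z → (if does (Dom? z) then (if good-A y z then false else true) else false) ≡ false → good-A y z ≡ true
      good q e with Dom? z | good-A y z
      ... | no ¬q | _    = contradiction q ¬q
      ... | yes _ | true = ≡.refl

    encoding : (∀ y z → GoodPair y z) → Encoding R D wd value-A value-b
    encoding good = record
      { encode-A = λ {y} {z} p q r → mk⇔
          (to (agrees⇒values (proj₂ (good y z p) q) (∈-allFin r)) ∘ dec-true (A? r y z))
          (does-true (A? r y z) ∘ from (agrees⇒values (proj₂ (good y z p) q) (∈-allFin r)))
      ; encode-b = λ {y} p r → mk⇔
          (to (agrees⇒values (proj₁ (good y y p)) (∈-allFin r)) ∘ dec-true (b? r y))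
          (does-true (b? r y) ∘ from (agrees⇒values (proj₁ (good y y p)) (∈-allFin r)))
      }

    solve⇒good : IInSolve R D → ∀ y z → GoodPair y z
    solve⇒good h y z p = agreeing (λ r → b? r y) (solve⇒functional-b R D wd h p) ,
      λ q → agreeing (λ r → A? r y z) (solve⇒functional-A R D wd h p q)
      where
      agreeing : ∀ {Q : Carrier R → Set} (Q? : ∀ r → Dec (Q r)) → (∃ λ a → ∀ r → Q r ⇔ (a ≡ r)) →
        agrees (allFin _) (λ r → does (Q? r)) (search 0# (allFin _) (λ r → does (Q? r))) ≡ true
      agreeing Q? (a , f) = ≡.subst (λ x → agrees (allFin _) (λ r → does (Q? r)) x ≡ true)
        (≡.sym (search-values V (∈-allFin a))) (values⇒agrees (allFin _) V)
        where
        V : Values (λ r → does (Q? r)) a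
        V r = mk⇔ (to (f r) ∘ does-true (Q? r)) (dec-true (Q? r) ∘ from (f r))

  solve⇒normal : IInSolve R D → InSpan matrix vector
  solve⇒normal h = span-resp (λ r → sym (vector≡ r))
    (span-linear Λ Λ-zero Λ-axpy column (solve⇒span R D wd (encoding good) h))
    where
    good = solve⇒good h

    extend : ∀ {y} → (Dom y → Carrier R) → Dec (Dom y) → Carrier R
    extend w (yes p) = w p
    extend w (no _)  = 0#

    Λ : (Σ Tuple Dom → Carrier R) → Tuple × Tuple → Carrier R
    Λ w (y , _) = extend (λ p → w (y , p)) (Dom? y)

    Λ-zero : ∀ {w} → (∀ i → w i ≡ 0#) → ∀ r → Λ w r ≡ 0#
    Λ-zero z (y , _) with Dom? y
    ... | yes p = z (y , p)
    ... | no  _ = ≡.refl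

    Λ-axpy : ∀ {c u w x} → (∀ i → u i ≡ c * w i + x i) → ∀ r → Λ u r ≡ c * Λ w r + Λ x r
    Λ-axpy e (y , _) with Dom? y
    ... | yes p = e (y , p)
    ... | no  _ = sym (≡.trans (+-identityʳ _) (zeroʳ _))

    matrix≡ : ∀ z′ (q : Dom z′) r → matrix r z′ ≡ Λ (λ (y , _) → value-A y z′) r
    matrix≡ z′ q (y , z) rewrite good⇒¬bad (good y z) | dec-true (Dom? z′) q with Dom? y
    ... | yes _ = ≡.refl
    ... | no  _ = ≡.refl

    vector≡ : ∀ r → vector r ≡ Λ (λ (y , _) → value-b y) r
    vector≡ (y , z) rewrite good⇒¬bad (good y z) with Dom? y
    ... | yes _ = ≡.refl
    ... | no  _ = ≡.refl

    column : ∀ z → InSpan matrix (Λ (λ (y , _) → value-A y (proj₁ z)))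
    column (z′ , q) = span-resp (matrix≡ z′ q) (span-gen z′)

  normal⇒solve : InSpan matrix vector → IInSolve R D
  normal⇒solve s = span⇒solve R D wd (encoding good) Dom? Eqv?
    -- Once no pair is bad, the diagonal rows (y , y) contain every equation.
    (span-resp (λ (y , p) → vector≡ p) (span-pull (λ (y , _) → y , y) (λ z → column z (Dom? z)) s))
    where
    not-bad : ∀ y z → bad y z ≡ false
    not-bad y z with bad y z in e
    ... | false = ≡.refl
    ... | true  = contradiction (≡.trans (≡.sym (vector-bad e)) (span-zero-row (y , z) (matrix-bad e) s)) σ₀≢0
      where
      vector-bad : bad y z ≡ true → vector (y , z) ≡ σ₀
      vector-bad e rewrite e = ≡.refl

      matrix-bad : bad y z ≡ true → ∀ z′ → matrix (y , z) z′ ≡ 0#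
      matrix-bad e z′ rewrite e = ≡.refl

    good : ∀ y z → GoodPair y z
    good y z = ¬bad⇒good (not-bad y z)

    vector≡ : ∀ {y} → Dom y → vector (y , y) ≡ value-b y
    vector≡ {y} p rewrite not-bad y y | dec-true (Dom? y) p = ≡.refl

    matrix-Dom : ∀ {y z′} → Dom y → Dom z′ → matrix (y , y) z′ ≡ value-A y z′
    matrix-Dom {y} {z′} p q rewrite not-bad y y | dec-true (Dom? y) p | dec-true (Dom? z′) q = ≡.refl

    matrix-¬Dom : ∀ {y z′} → Dom y → ¬ Dom z′ → matrix (y , y) z′ ≡ 0#
    matrix-¬Dom {y} {z′} p ¬q rewrite not-bad y y | dec-true (Dom? y) p | dec-false (Dom? z′) ¬q = ≡.refl

    column : ∀ z′ → Dec (Dom z′) →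
      InSpan {Σ Tuple Dom} {Σ Tuple Dom} (λ (y , _) (z , _) → value-A y z) (λ (y , _) → matrix (y , y) z′)
    column z′ (yes q) = span-resp (λ (y , p) → sym (matrix-Dom p q)) (span-gen (z′ , q))
    column z′ (no ¬q) = nil (λ (y , p) → matrix-¬Dom p ¬q)

-- Definable systems

-- A tag is coded by which later entry of a tuple is the first to differ from the initial one, so only universes with
-- at least two elements have codes for all tags; in a one-element universe every tuple codes the default t₀.
module _ {T : Set} where

  private
    -- Leaves out position 1, so that position 0 remains the entry with which all later ones are
    -- compared.
    skip : ∀ {m} → Fin (suc m) → Fin (suc (suc m))
    skip zero    = zero
    skip (suc i) = suc (suc i)

  decode : T → (ts : List T) → ∀ {n} → (Fin (suc (List.length ts)) → Fin n) → T
  decode t₀ []       ρ = t₀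
  decode t₀ (t ∷ ts) ρ = if does (ρ zero Fin.≟ ρ (suc zero)) then decode t₀ ts (ρ ∘ skip) else t

  decode-cong : ∀ {t₀} ts {n} {ρ ρ′ : Fin (suc (List.length ts)) → Fin n} → ρ ≗ ρ′ → decode t₀ ts ρ ≡ decode t₀ ts ρ′
  decode-cong []       e = ≡.refl
  decode-cong (t ∷ ts) e rewrite e zero | e (suc zero) = ≡.cong (if _ then_else t) (decode-cong ts (e ∘ skip))

  decode-surjective : ∀ {t₀ ts t} n → t ∈ ts → ∃ λ w → decode t₀ ts {suc (suc n)} (lookup w) ≡ t
  decode-surjective {ts = _ ∷ ts} n (here ≡.refl) = zero ∷ suc zero ∷ replicate _ zero , ≡.refl
  -- Repeating the head makes the first comparison succeed, which passes decoding on to the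
  -- remaining tags.
  decode-surjective {t₀} {t₁ ∷ ts} n (there t∈) with decode-surjective {t₀} {ts} n t∈
  ... | x ∷ w , e = x ∷ x ∷ w , ≡.trans
    (≡.cong (λ b → if b then decode t₀ ts (lookup (x ∷ x ∷ w) ∘ skip) else t₁) (dec-true (x Fin.≟ x) ≡.refl))
    (≡.trans (decode-cong ts {ρ′ = lookup (x ∷ w)} (λ { zero → ≡.refl ; (suc i) → ≡.refl })) e)

  decode-trivial : ∀ {t₀} ts (ρ : Fin (suc (List.length ts)) → Fin 1) → decode t₀ ts ρ ≡ t₀
  decode-trivial []       ρ = ≡.refl
  decode-trivial (t ∷ ts) ρ with ρ zero | ρ (suc zero)
  ... | zero | zero = decode-trivial ts (ρ ∘ skip)

size-of : Code → ℕ
size-of (tup d)  = d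
size-of (c ⊗ c′) = size-of c ℕ.+ size-of c′

unflatten : ∀ c → Sub (tup (size-of c)) c
unflatten (tup d)  = idˢ
unflatten (c ⊗ c′) = ⟨ unflatten c ⊙ restrict (_↑ˡ size-of c′) , unflatten c′ ⊙ restrict (size-of c ↑ʳ_) ⟩
  where
  restrict : ∀ {d e} → (Fin e → Fin d) → Sub (tup d) (tup e)
  restrict f = record
    { map = λ x → tabulate (lookup x ∘ f) ; var = f ; natural = λ x v → ≡.sym (Vec.lookup∘tabulate (lookup x ∘ f) v) }

flatten : ∀ c {n} → Tup c n → Vec (Fin n) (size-of c)
flatten (tup d)  x       = x
flatten (c ⊗ c′) (x , y) = flatten c x Vec.++ flatten c′ y

unflatten-flatten : ∀ c {n} (x : Tup c n) → map (unflatten c) (flatten c x) ≡ x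
unflatten-flatten (tup d)  x       = ≡.refl
unflatten-flatten (c ⊗ c′) (x , y) = ≡.cong₂ _,_
  (≡.trans (≡.cong (map (unflatten c)) (tabulated (flatten c x) (Vec.lookup-++ˡ (flatten c x) (flatten c′ y))))
    (unflatten-flatten c x))
  (≡.trans (≡.cong (map (unflatten c′)) (tabulated (flatten c′ y) (Vec.lookup-++ʳ (flatten c x) (flatten c′ y))))
    (unflatten-flatten c′ y))
  where
  tabulated : ∀ {A : Set} {m} (y : Vec A m) {f : Fin m → A} → f ≗ lookup y → tabulate f ≡ y
  tabulated y e = ≡.trans (Vec.tabulate-cong e) (Vec.tabulate∘lookup y)

module Systems (R : FinCommRing) {p : ℕ} (k : ℕ) (pr : Prime p) (char : IsCharacteristic R (p ^ suc k))
  {σ : Signature} (𝓛 : Fragment R σ) where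
  open CommutativeRing (commRing R) hiding (zero; Carrier)
  open Span (commRing R)
  open PrimeSubring R k pr char using (ι; socle; socle≢0)
  open Dual R k pr char
  open Fragment 𝓛
  open Definability R 𝓛

  private
    𝕂 : Set
    𝕂 = Carrier R

  def-cong : ∀ {c X} {F G : Fn c X} → (∀ n 𝒜 v → F n 𝒜 v ≡ G n 𝒜 v) → Definable c F → Definable c G
  def-cong F≡G dF x = let φ , Pφ , φ⇔ = dF x in φ , Pφ , λ n 𝒜 v →
    ≡.subst (λ y → Sat R 𝒜 φ (get _ v) ⇔ (y ≡ x)) (F≡G n 𝒜 v) (φ⇔ n 𝒜 v)

  def-decode : ∀ {T c X} {t₀ : T} (ts : List T) (f : Fin (suc (List.length ts)) → Var c) {G : T → Fn c X} →
    (∀ t → Definable c (G t)) → Definable c (λ n 𝒜 v → G (decode t₀ ts (get c v ∘ f)) n 𝒜 v)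
  def-decode []       f dG = dG _
  def-decode {c = c} (t ∷ ts) f {G} dG = def-cong
    (λ n 𝒜 v → ≡.sym (Bool.if-float (λ t → G t n 𝒜 v) (does (get c v (f zero) Fin.≟ get c v (f (suc zero))))))
    (def-if (def-decidable (Formula.eq (f zero) (f (suc zero))) (P-eq _ _) (λ _ _ _ → ⇔-refl) (λ _ _ _ → _ Fin.≟ _))
      (def-decode ts _ dG) (dG t))

  -- Systems are rectangular, with unrelated shapes of rows and columns. They become square only
  -- when interpreted, where a tuple names a row and a column at once.
  record System (j : ℕ) : Set₁ where
    field
      rows cols : Code
      M         : Fn (tup j ⊗ rows ⊗ cols) 𝕂
      M-def     : Definable (tup j ⊗ rows ⊗ cols) M
      v         : Fn (tup j ⊗ rows) 𝕂
      v-def     : Definable (tup j ⊗ rows) v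

    matrixAt : ∀ n → Struct σ (suc n) → Vec (Fin (suc n)) j → Tup rows (suc n) → Tup cols (suc n) → 𝕂
    matrixAt n 𝒜 a r c = M n 𝒜 (a , r , c)

    vectorAt : ∀ n → Struct σ (suc n) → Vec (Fin (suc n)) j → Tup rows (suc n) → 𝕂
    vectorAt n 𝒜 a r = v n 𝒜 (a , r)

    Solves : ∀ n → Struct σ (suc n) → Vec (Fin (suc n)) j → Set
    Solves n 𝒜 a = InSpan (matrixAt n 𝒜 a) (vectorAt n 𝒜 a)

  -- Block matrices with finitely many kinds of rows and columns. The defaults `row₀` and `col₀`
  -- designate the single block that remains visible in a one-element universe.
  record TaggedSystem (j : ℕ) : Set₁ where
    field
      rowTag colTag   : Set
      row₀            : rowTag
      col₀            : colTag
      rowTags         : List rowTag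
      colTags         : List colTag
      ∈rowTags        : ∀ τ → τ ∈ rowTags
      ∈colTags        : ∀ τ → τ ∈ colTags
      rows cols       : Code
      M               : rowTag → colTag → Fn (tup j ⊗ rows ⊗ cols) 𝕂
      M-def           : ∀ τ τ′ → Definable (tup j ⊗ rows ⊗ cols) (M τ τ′)
      v               : rowTag → Fn (tup j ⊗ rows) 𝕂
      v-def           : ∀ τ → Definable (tup j ⊗ rows) (v τ)

    Solvesᵗ : ∀ n → Struct σ (suc n) → Vec (Fin (suc n)) j → Set
    Solvesᵗ n 𝒜 a = InSpan {rowTag × Tup rows (suc n)} {colTag × Tup cols (suc n)}
      (λ (τ , r) (τ′ , c) → M τ τ′ n 𝒜 (a , r , c)) (λ (τ , r) → v τ n 𝒜 (a , r))

    rowDigits colDigits : ℕ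
    rowDigits = suc (List.length rowTags)
    colDigits = suc (List.length colTags)

    private
      decodeʳ : ∀ {n} → Vec (Fin n) rowDigits → rowTag
      decodeʳ w = decode row₀ rowTags (lookup w)

      decodeᶜ : ∀ {n} → Vec (Fin n) colDigits → colTag
      decodeᶜ w = decode col₀ colTags (lookup w)

    untag : System j
    untag = record
      { rows  = tup rowDigits ⊗ rows
      ; cols  = tup colDigits ⊗ cols
      ; M     = λ { n 𝒜 (a , (w , r) , (w′ , c)) → M (decodeʳ w) (decodeᶜ w′) n 𝒜 (a , r , c) }
      ; M-def = def-decode rowTags (inj₂ ∘ inj₁ ∘ inj₁) (λ τ → def-decode colTags (inj₂ ∘ inj₂ ∘ inj₁) (λ τ′ →
                  def-sub ⟨ π₁ , ⟨ π₂ ⊙ π₁ ⊙ π₂ , π₂ ⊙ π₂ ⊙ π₂ ⟩ ⟩ (M-def τ τ′)))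
      ; v     = λ { n 𝒜 (a , (w , r)) → v (decodeʳ w) n 𝒜 (a , r) }
      ; v-def = def-decode rowTags (inj₂ ∘ inj₁) (λ τ → def-sub ⟨ π₁ , π₂ ⊙ π₂ ⟩ (v-def τ))
      }

    untag-trivial-M : ∀ 𝒜 a w w′ r c → System.M untag 0 𝒜 (a , (w , r) , (w′ , c)) ≡ M row₀ col₀ 0 𝒜 (a , r , c)
    untag-trivial-M 𝒜 a w w′ r c = ≡.cong₂ (λ τ τ′ → M τ τ′ 0 𝒜 (a , r , c))
      (decode-trivial rowTags (lookup w)) (decode-trivial colTags (lookup w′))

    untag-trivial-v : ∀ 𝒜 a w r → System.v untag 0 𝒜 (a , (w , r)) ≡ v row₀ 0 𝒜 (a , r)
    untag-trivial-v 𝒜 a w r = ≡.cong (λ τ → v τ 0 𝒜 (a , r)) (decode-trivial rowTags (lookup w))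

    untag-solves : ∀ n 𝒜 a → System.Solves untag (suc n) 𝒜 a ⇔ Solvesᵗ (suc n) 𝒜 a
    untag-solves n 𝒜 a = mk⇔
      (λ s → span-resp (λ (τ , r) → ≡.cong (λ τ → v τ (suc n) 𝒜 (a , r)) (codeʳ-correct τ))
        (span-pull (λ (τ , r) → codeʳ τ , r) (λ (w′ , c) → span-resp
          (λ (τ , r) → ≡.cong (λ τ → M τ (decodeᶜ w′) (suc n) 𝒜 (a , r , c)) (≡.sym (codeʳ-correct τ)))
          (span-gen (decodeᶜ w′ , c))) s))
      (span-pull (λ (w , r) → decodeʳ w , r) (λ (τ′ , c) → span-resp
        (λ (w , r) → ≡.cong (λ τ′ → M (decodeʳ w) τ′ (suc n) 𝒜 (a , r , c)) (codeᶜ-correct τ′))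
        (span-gen (codeᶜ τ′ , c))))
      where
      codeʳ : rowTag → Vec (Fin (suc (suc n))) rowDigits
      codeʳ τ = proj₁ (decode-surjective n (∈rowTags τ))

      codeʳ-correct : ∀ τ → decodeʳ (codeʳ τ) ≡ τ
      codeʳ-correct τ = proj₂ (decode-surjective n (∈rowTags τ))

      codeᶜ : colTag → Vec (Fin (suc (suc n))) colDigits
      codeᶜ τ = proj₁ (decode-surjective n (∈colTags τ))

      codeᶜ-correct : ∀ τ → decodeᶜ (codeᶜ τ) ≡ τ
      codeᶜ-correct τ = proj₂ (decode-surjective n (∈colTags τ))

  -- A vector is the sum of its restrictions to the fibres of `π`, so each restriction can be
  -- treated on its own.
  span-indicator : ∀ {B I J : Set} {M : I → J → 𝕂} (_≟_ : DecidableEquality B) (bs : List B) → (∀ b → b ∈ bs) →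
    (π : I → B) (w : B → I → 𝕂) → (∀ b → InSpan M (λ i → if does (b ≟ π i) then w b i else 0#)) →
    InSpan M (λ i → w (π i) i)
  span-indicator _≟_ bs ∈bs π w s = span-resp
    (λ i → ≡.trans (eval-indicator _≟_ (λ _ → 1#) (λ b → w b i) (deduplicate-! _≟_ bs) (∈-deduplicate⁺ _≟_ (∈bs (π i))))
                   (*-identityˡ _))
    (span-combine (List.map (λ b → b , 1#) (deduplicate _≟_ bs)) s)

  span-extend : ∀ {I I′ J J′ : Set} {M : I → J → 𝕂} {M′ : I′ → J′ → 𝕂} (B : I′ → Bool) (f : I′ → I) →
    (∀ j → InSpan M′ (λ i → if B i then M (f i) j else 0#)) →
    ∀ {v} → InSpan M v → InSpan M′ (λ i → if B i then v (f i) else 0#)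
  span-extend B f = span-linear (λ w i → if B i then w (f i) else 0#)
    (λ z i → on-zero (B i) (z (f i))) (λ e i → on-axpy (B i) (e (f i)))
    where
    on-zero : ∀ b {x} → x ≡ 0# → (if b then x else 0#) ≡ 0#
    on-zero true  e = e
    on-zero false e = ≡.refl

    on-axpy : ∀ b {c x y z} → x ≡ c * y + z → (if b then x else 0#) ≡ c * (if b then y else 0#) + (if b then z else 0#)
    on-axpy true  e = e
    on-axpy false e = sym (≡.trans (+-identityʳ _) (zeroʳ _))

  bools : List Bool
  bools = false ∷ true ∷ []

  ∈-bools : ∀ b → b ∈ bools
  ∈-bools false = here ≡.refl
  ∈-bools true  = there (here ≡.refl)

  module _ {j : ℕ} (row₀ col₀ : Bool) (S₁ S₂ : System j) where
    private
      module S₁ = System S₁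
      module S₂ = System S₂

    -- Shapes have products but no sums. An index of the disjoint union is therefore a tag with a
    -- pair of indices, of which the tag selects one; the other component only produces copies.
    block : TaggedSystem j
    block = record
      { rowTag = Bool ; colTag = Bool ; row₀ = row₀ ; col₀ = col₀
      ; rowTags = bools ; colTags = bools ; ∈rowTags = ∈-bools ; ∈colTags = ∈-bools
      ; rows = S₁.rows ⊗ S₂.rows
      ; cols = S₁.cols ⊗ S₂.cols
      ; M = λ { true  true  n 𝒜 (a , (r , _) , (c , _)) → S₁.M n 𝒜 (a , r , c)
              ; false false n 𝒜 (a , (_ , r) , (_ , c)) → S₂.M n 𝒜 (a , r , c)
              ; true  false n 𝒜 _ → 0#
              ; false true  n 𝒜 _ → 0# }
      ; M-def = λ { true  true  → def-sub ⟨ π₁ , ⟨ π₁ ⊙ π₁ ⊙ π₂ , π₁ ⊙ π₂ ⊙ π₂ ⟩ ⟩ S₁.M-def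
                  ; false false → def-sub ⟨ π₁ , ⟨ π₂ ⊙ π₁ ⊙ π₂ , π₂ ⊙ π₂ ⊙ π₂ ⟩ ⟩ S₂.M-def
                  ; true  false → def-const Fin._≟_ 0#
                  ; false true  → def-const Fin._≟_ 0# }
      ; v = λ { true n 𝒜 (a , (r , _)) → S₁.v n 𝒜 (a , r) ; false n 𝒜 (a , (_ , r)) → S₂.v n 𝒜 (a , r) }
      ; v-def = λ { true → def-sub ⟨ π₁ , π₁ ⊙ π₂ ⟩ S₁.v-def ; false → def-sub ⟨ π₁ , π₂ ⊙ π₂ ⟩ S₂.v-def }
      }

    block-solves : ∀ n 𝒜 a → TaggedSystem.Solvesᵗ block n 𝒜 a ⇔ (S₁.Solves n 𝒜 a × S₂.Solves n 𝒜 a)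
    block-solves n 𝒜 a = mk⇔
      (λ s → span-pull (λ r → true , r , constant S₂.rows zero)
               (λ { (true , c , _) → span-gen c ; (false , _) → nil (λ _ → ≡.refl) }) s ,
             span-pull (λ r → false , constant S₁.rows zero , r)
               (λ { (false , _ , c) → span-gen c ; (true , _) → nil (λ _ → ≡.refl) }) s)
      (λ (s₁ , s₂) → span-resp
        (λ { (true , _) → ≡.trans (+-identityʳ _) (*-identityˡ _)
           ; (false , _) → ≡.trans (+-identityˡ′ _) (+-identityˡ _) })
        (span-axpy 1#
          (span-extend proj₁ (proj₁ ∘ proj₂) (λ c → span-resp
            (λ { (true , _) → ≡.refl ; (false , _) → ≡.refl }) (span-gen (true , c , constant S₂.cols zero))) s₁)
          (span-extend (not ∘ proj₁) (proj₂ ∘ proj₂) (λ c → span-resp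
            (λ { (true , _) → ≡.refl ; (false , _) → ≡.refl }) (span-gen (false , constant S₁.cols zero , c))) s₂)))
      where
      +-identityˡ′ : ∀ x → 1# * 0# + x ≡ 0# + x
      +-identityˡ′ x = ≡.cong (_+ x) (zeroʳ 1#)

  module _ {j : ℕ} {θ : Fn (tup 1) Bool} (θ-def : Definable (tup 1) θ) where

    -- Solvable in every universe, but consisting of the equation 0 = [¬ θ] pᵏ once its columns are cut off.
    slack : System j
    slack = record
      { rows  = tup 1
      ; cols  = tup 1
      ; M     = λ { n 𝒜 (a , b , b′) → if does (_≟ᵗ_ {tup 1} b′ b) then 1# else 0# }
      ; M-def = def-if (def-≟ (π₂ ⊙ π₂) (π₁ ⊙ π₂)) (def-const Fin._≟_ 1#) (def-const Fin._≟_ 0#)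
      ; v     = λ { n 𝒜 (a , b) → if θ n 𝒜 b then 0# else socle }
      ; v-def = def-if (def-sub π₂ θ-def) (def-const Fin._≟_ 0#) (def-const Fin._≟_ socle)
      }

    slack-solves : ∀ n 𝒜 a → System.Solves slack n 𝒜 a
    slack-solves n 𝒜 a = span-indicator (_≟ᵗ_ {tup 1}) (tuples (tup 1) (suc n)) (∈-tuples (tup 1)) id
      (λ b _ → if θ n 𝒜 b then 0# else socle)
      (λ b → span-resp (λ i → scale (does (_≟ᵗ_ {tup 1} b i))) (span-scale _ (span-gen b)))
      where
      scale : ∀ b {x} → x * (if b then 1# else 0#) ≡ (if b then x else 0#)
      scale true  = *-identityʳ _
      scale false = zeroʳ _

  module _ {j : ℕ} (S : System (suc j)) where
    open System S

    forallSystem : System j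
    forallSystem = record
      { rows  = tup 1 ⊗ rows
      ; cols  = tup 1 ⊗ cols
      -- The parameter is taken from the column, not from the row, so that each column is literally
      -- a column of one block extended by zero.
      ; M     = λ { n 𝒜 (a , (b , r) , (b′ , c)) →
                  if does (_≟ᵗ_ {tup 1} b′ b) then M n 𝒜 (lookup b′ zero ∷ a , r , c) else 0# }
      ; M-def = def-if (def-≟ (π₁ ⊙ π₂ ⊙ π₂) (π₁ ⊙ π₁ ⊙ π₂))
                  (def-sub ⟨ consˢ ⊙ ⟨ π₁ ⊙ π₂ ⊙ π₂ , π₁ ⟩ , ⟨ π₂ ⊙ π₁ ⊙ π₂ , π₂ ⊙ π₂ ⊙ π₂ ⟩ ⟩ M-def)
                  (def-const Fin._≟_ 0#)
      ; v     = λ { n 𝒜 (a , b , r) → v n 𝒜 (lookup b zero ∷ a , r) }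
      ; v-def = def-sub ⟨ consˢ ⊙ ⟨ π₁ ⊙ π₂ , π₁ ⟩ , π₂ ⊙ π₂ ⟩ v-def
      }

    forall-solves : ∀ n 𝒜 a → System.Solves forallSystem n 𝒜 a ⇔ (∀ b → Solves n 𝒜 (b ∷ a))
    forall-solves n 𝒜 a = mk⇔
      (λ s b → span-pull (λ r → b ∷ [] , r) (λ (b′ , c) → column b b′ c) s)
      (λ s → span-indicator (_≟ᵗ_ {tup 1}) (tuples (tup 1) (suc n)) (∈-tuples (tup 1)) proj₁
        (λ b (_ , r) → v n 𝒜 (lookup b zero ∷ a , r))
        (λ b → span-extend (λ (b′ , _) → does (_≟ᵗ_ {tup 1} b b′)) proj₂ (λ c → span-gen (b , c)) (s (lookup b zero))))
      where
      column : ∀ b b′ c → InSpan (matrixAt n 𝒜 (b ∷ a))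
        (λ r → if does (_≟ᵗ_ {tup 1} b′ (b ∷ [])) then M n 𝒜 (lookup b′ zero ∷ a , r , c) else 0#)
      column b b′ c with _≟ᵗ_ {tup 1} b′ (b ∷ [])
      ... | yes ≡.refl = span-gen c
      ... | no  _      = nil (λ _ → ≡.refl)

  module _ {j : ℕ} (S : System j) where
    open System S

    -- Ring elements t become column tags. Each entry of the dual depends on at most one entry of
    -- `M` or `v` and on equality of row indices, and this is why dualising needs no quantifiers.
    dualSystem : TaggedSystem j
    dualSystem = record
      { rowTag = DualTag ; colTag = 𝕂 ; row₀ = inj₂ (inj₂ tt) ; col₀ = 0#
      ; rowTags = dualTags ; colTags = allFin _ ; ∈rowTags = ∈-dualTags ; ∈colTags = ∈-allFin
      ; rows = rows ⊗ cols
      ; cols = rows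
      ; M = λ { τ t n 𝒜 (a , r , i) → dual (_≟ᵗ_ {rows}) (matrixAt n 𝒜 a) (vectorAt n 𝒜 a) (τ , r) (t , i) }
      ; M-def = λ
          { (inj₁ (r , s)) t → def-cong (λ { n 𝒜 (a , (i , _) , i′) → ≡.sym (Bool.if-float ι (does (_≟ᵗ_ {rows} i i′))) })
              (def-if (def-≟ (π₁ ⊙ π₁ ⊙ π₂) (π₂ ⊙ π₂)) (def-const Fin._≟_ (ι (additivity r s t))) (def-const Fin._≟_ (ι 0)))
          ; (inj₂ (inj₁ r)) t → def-map Fin._≟_ (λ x → ι (δ (r * x) t)) (def-sub ⟨ π₁ , ⟨ π₂ ⊙ π₂ , π₂ ⊙ π₁ ⊙ π₂ ⟩ ⟩ M-def)
          ; (inj₂ (inj₂ _)) t → def-map Fin._≟_ (λ x → ι (δ x t)) (def-sub ⟨ π₁ , π₂ ⊙ π₂ ⟩ v-def)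
          }
      ; v = λ τ n 𝒜 _ → ι (dualTarget τ)
      ; v-def = λ τ → def-const Fin._≟_ (ι (dualTarget τ))
      }

    dual-or-solves : ∀ n 𝒜 a → TaggedSystem.Solvesᵗ dualSystem n 𝒜 a ⊎ Solves n 𝒜 a
    dual-or-solves n 𝒜 a =
      dual-complete (_≟ᵗ_ {rows}) (tuples rows (suc n)) (∈-tuples rows) (tuples cols (suc n)) (∈-tuples cols)

    dual-solves : ∀ n 𝒜 a → TaggedSystem.Solvesᵗ dualSystem n 𝒜 a ⇔ (¬ Solves n 𝒜 a)
    dual-solves n 𝒜 a = mk⇔
      (dual-sound (_≟ᵗ_ {rows}) (tuples rows (suc n)) (∈-tuples rows) (constant rows zero) (constant cols zero))
      (λ ¬s → [ id , (λ s → contradiction s ¬s) ]′ (dual-or-solves n 𝒜 a))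

    -- Decidability comes from duality, since whichever of the two systems is solvable settles the
    -- question. It is what yields a witness from ¬ ∀ ¬ in the existential case.
    solves? : ∀ n 𝒜 a → Dec (Solves n 𝒜 a)
    solves? n 𝒜 a with dual-or-solves n 𝒜 a
    ... | inj₁ d = no (to (dual-solves n 𝒜 a) d)
    ... | inj₂ s = yes s

-- From interpretations to definable systems and back

module Closure (R : FinCommRing) {p : ℕ} (k : ℕ) (pr : Prime p) (char : IsCharacteristic R (p ^ suc k))
  {σ : Signature} (𝓛 : Fragment R σ) where
  open CommutativeRing (commRing R) hiding (zero; Carrier)
  open Span (commRing R)
  open PrimeSubring R k pr char using (socle; socle≢0)
  open Fragment 𝓛
  open Definability R 𝓛
  open Systems R k pr char 𝓛

  ReducibleBy : ∀ {j} → Query σ j → Set₁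
  ReducibleBy {j} q = Σ (Interp R σ j) λ I → AllFormulas R P I × ReducesVia R I q

  def-search : ∀ {c k r₀} {B : Fin k → Fn c Bool} rs → (∀ r → Definable c (B r)) →
    Definable c (λ n 𝒜 v → search r₀ rs (λ r → B r n 𝒜 v))
  def-search []       dB = def-const Fin._≟_ _
  def-search (r ∷ rs) dB = def-if (dB r) (def-const Fin._≟_ r) (def-search rs dB)

  def-agrees : ∀ {c k} {B : Fin k → Fn c Bool} rs u → (∀ r → Definable c (B r)) →
    Definable c (λ n 𝒜 v → agrees rs (λ r → B r n 𝒜 v) u)
  def-agrees []       u dB = def-const Bool._≟_ true
  def-agrees (r ∷ rs) u dB = def-if (dB r)
    (def-if (def-const Bool._≟_ _) (def-agrees rs u dB) (def-const Bool._≟_ false))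
    (def-if (def-const Bool._≟_ _) (def-const Bool._≟_ false) (def-agrees rs u dB))

  module FromInterpretation {j} (I : Interp R σ j) (PI : AllFormulas R P I)
    (wd : ∀ n (𝒜 : Struct σ (suc n)) a → WellDef R (⟦_⟧ R I 𝒜 a)) where
    open Interp I renaming (dim to d)

    module _ (n : ℕ) (𝒜 : Struct σ (suc n)) (a : Vec (Fin (suc n)) j) where
      open IData (⟦_⟧ R I 𝒜 a)

      Dom? : ∀ y → Dec (Dom y)
      Dom? y = decide (proj₁ PI) 𝒜 [ lookup a , lookup y ]

      Eqv? : ∀ y z → Dec (Eqv y z)
      Eqv? y z = decide (proj₁ (proj₂ PI)) 𝒜 [ lookup a , pick R (y ∷ z ∷ []) ]

      Rel? : ∀ s ys → Dec (Rel s ys)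
      Rel? s ys = decide (proj₂ (proj₂ PI) s) 𝒜 [ lookup a , pick R ys ]

      module N = Normalise R socle≢0 (wd n 𝒜 a) Dom? Eqv?
        (λ r y z → Rel? (inj₁ r) (y ∷ z ∷ [])) (λ r y → Rel? (inj₂ r) (y ∷ []))

    private
      pairVar : Fin j ⊎ (Fin 2 × Fin d) → Var (tup j ⊗ tup d ⊗ tup d)
      pairVar (inj₁ i)              = inj₁ i
      pairVar (inj₂ (zero , i))     = inj₂ (inj₁ i)
      pairVar (inj₂ (suc zero , i)) = inj₂ (inj₂ i)

      singleVar : Fin j ⊎ (Fin 1 × Fin d) → Var (tup j ⊗ tup d)
      singleVar (inj₁ i)          = inj₁ i
      singleVar (inj₂ (zero , i)) = inj₂ i

      Dom-def : Definable (tup j ⊗ tup d) (λ n 𝒜 v → does (Dom? n 𝒜 (proj₁ v) (proj₂ v)))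
      Dom-def = def-decidable δ (proj₁ PI) (λ _ _ _ → ⇔-refl) (λ n 𝒜 v → Dom? n 𝒜 (proj₁ v) (proj₂ v))

      A-def : ∀ r → Definable (tup j ⊗ tup d ⊗ tup d)
        (λ n 𝒜 v → does (Rel? n 𝒜 (proj₁ v) (inj₁ r) (proj₁ (proj₂ v) ∷ proj₂ (proj₂ v) ∷ [])))
      A-def r = def-decidable (rename R pairVar (φ (inj₁ r))) (P-rename pairVar (proj₂ (proj₂ PI) (inj₁ r)))
        (λ n 𝒜 v → sat-rename R 𝒜 (φ (inj₁ r))
          (λ { (inj₁ i) → ≡.refl ; (inj₂ (zero , i)) → ≡.refl ; (inj₂ (suc zero , i)) → ≡.refl }))
        (λ n 𝒜 v → Rel? n 𝒜 (proj₁ v) (inj₁ r) (proj₁ (proj₂ v) ∷ proj₂ (proj₂ v) ∷ []))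

      b-def : ∀ r → Definable (tup j ⊗ tup d) (λ n 𝒜 v → does (Rel? n 𝒜 (proj₁ v) (inj₂ r) (proj₂ v ∷ [])))
      b-def r = def-decidable (rename R singleVar (φ (inj₂ r))) (P-rename singleVar (proj₂ (proj₂ PI) (inj₂ r)))
        (λ n 𝒜 v → sat-rename R 𝒜 (φ (inj₂ r)) (λ { (inj₁ i) → ≡.refl ; (inj₂ (zero , i)) → ≡.refl }))
        (λ n 𝒜 v → Rel? n 𝒜 (proj₁ v) (inj₂ r) (proj₂ v ∷ []))

      value-A-def : Definable (tup j ⊗ tup d ⊗ tup d) (λ n 𝒜 v → N.value-A n 𝒜 (proj₁ v) (proj₁ (proj₂ v)) (proj₂ (proj₂ v)))
      value-A-def = def-search (allFin _) A-def

      value-b-def : Definable (tup j ⊗ tup d) (λ n 𝒜 v → N.value-b n 𝒜 (proj₁ v) (proj₂ v))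
      value-b-def = def-search (allFin _) b-def

      good-A-def : Definable (tup j ⊗ tup d ⊗ tup d) (λ n 𝒜 v → N.good-A n 𝒜 (proj₁ v) (proj₁ (proj₂ v)) (proj₂ (proj₂ v)))
      good-A-def = def-bind value-A-def (λ u → def-agrees (allFin _) u A-def)

      good-b-def : Definable (tup j ⊗ tup d) (λ n 𝒜 v → N.good-b n 𝒜 (proj₁ v) (proj₂ v))
      good-b-def = def-bind value-b-def (λ u → def-agrees (allFin _) u b-def)

      bad-def : Definable (tup j ⊗ tup d ⊗ tup d) (λ n 𝒜 v → N.bad n 𝒜 (proj₁ v) (proj₁ (proj₂ v)) (proj₂ (proj₂ v)))
      bad-def = def-if (def-sub first Dom-def)
        (def-if (def-sub first good-b-def)
          (def-if (def-sub second Dom-def)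
            (def-if good-A-def (def-const Bool._≟_ false) (def-const Bool._≟_ true))
            (def-const Bool._≟_ false))
          (def-const Bool._≟_ true))
        (def-const Bool._≟_ false)
        where
        first second : Sub (tup j ⊗ tup d ⊗ tup d) (tup j ⊗ tup d)
        first  = ⟨ π₁ , π₁ ⊙ π₂ ⟩
        second = ⟨ π₁ , π₂ ⊙ π₂ ⟩

    normalised : System j
    normalised = record
      { rows  = tup d ⊗ tup d
      ; cols  = tup d
      ; M     = λ { n 𝒜 (a , r , c) → N.matrix n 𝒜 a r c }
      ; M-def = def-if (def-sub ⟨ π₁ , π₁ ⊙ π₂ ⟩ bad-def) (def-const Fin._≟_ 0#)
                  (def-if (def-sub ⟨ π₁ , π₁ ⊙ π₁ ⊙ π₂ ⟩ Dom-def)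
                    (def-if (def-sub ⟨ π₁ , π₂ ⊙ π₂ ⟩ Dom-def)
                      (def-sub ⟨ π₁ , ⟨ π₁ ⊙ π₁ ⊙ π₂ , π₂ ⊙ π₂ ⟩ ⟩ value-A-def)
                      (def-const Fin._≟_ 0#))
                    (def-const Fin._≟_ 0#))
      ; v     = λ { n 𝒜 (a , r) → N.vector n 𝒜 a r }
      ; v-def = def-if bad-def (def-const Fin._≟_ socle)
                  (def-if (def-sub first Dom-def) (def-sub first value-b-def) (def-const Fin._≟_ 0#))
      }
      where
      first : Sub (tup j ⊗ tup d ⊗ tup d) (tup j ⊗ tup d)
      first = ⟨ π₁ , π₁ ⊙ π₂ ⟩

    normalised-solves : ∀ n 𝒜 a → IInSolve R (⟦_⟧ R I 𝒜 a) ⇔ System.Solves normalised n 𝒜 a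
    normalised-solves n 𝒜 a = mk⇔ (N.solve⇒normal n 𝒜 a) (N.normal⇒solve n 𝒜 a)

  module ToInterpretation {j} (S : System j) where
    open System S

    private
      d : ℕ
      d = size-of (rows ⊗ cols)

      rowOf : Sub (tup d) rows
      rowOf = π₁ ⊙ unflatten (rows ⊗ cols)

      colOf : Sub (tup d) cols
      colOf = π₂ ⊙ unflatten (rows ⊗ cols)

      square-def : Definable (tup j ⊗ tup d ⊗ tup d)
        (λ n 𝒜 v → M n 𝒜 (proj₁ v , map rowOf (proj₁ (proj₂ v)) , map colOf (proj₂ (proj₂ v))))
      square-def = def-sub ⟨ π₁ , ⟨ rowOf ⊙ π₁ ⊙ π₂ , colOf ⊙ π₂ ⊙ π₂ ⟩ ⟩ M-def

      vector-def : Definable (tup j ⊗ tup d) (λ n 𝒜 v′ → v n 𝒜 (proj₁ v′ , map rowOf (proj₂ v′)))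
      vector-def = def-sub ⟨ π₁ , rowOf ⊙ π₂ ⟩ v-def

      pairVar : Var (tup j ⊗ tup d ⊗ tup d) → Fin j ⊎ (Fin 2 × Fin d)
      pairVar = [ inj₁ , [ (λ i → inj₂ (zero , i)) , (λ i → inj₂ (suc zero , i)) ] ]

      singleVar : Var (tup j ⊗ tup d) → Fin j ⊎ (Fin 1 × Fin d)
      singleVar = [ inj₁ , (λ i → inj₂ (zero , i)) ]

    interpretation : Interp R σ j
    interpretation = record
      { dim = d
      ; δ   = tt
      ; ε   = equal (tup d) (λ i → inj₂ (zero , i)) (λ i → inj₂ (suc zero , i))
      ; φ   = λ { (inj₁ r) → rename R pairVar (proj₁ (square-def r))
                ; (inj₂ r) → rename R singleVar (proj₁ (vector-def r)) }
      }

    allFormulas : AllFormulas R P interpretation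
    allFormulas = P-tt , P-equal (tup d) ,
      λ { (inj₁ r) → P-rename pairVar (proj₁ (proj₂ (square-def r)))
        ; (inj₂ r) → P-rename singleVar (proj₁ (proj₂ (vector-def r))) }

    module _ (n : ℕ) (𝒜 : Struct σ (suc n)) (a : Vec (Fin (suc n)) j) where
      open IData (⟦_⟧ R interpretation 𝒜 a)

      private
        Eqv⇔ : ∀ y z → Eqv y z ⇔ (y ≡ z)
        Eqv⇔ y z = sat-equal (tup d) (λ _ → ≡.refl) (λ _ → ≡.refl)

        Eqv⇒≡ : ∀ {m} (ys zs : Vec (Vec (Fin (suc n)) d) m) → (∀ i → Eqv (lookup ys i) (lookup zs i)) → ys ≡ zs
        Eqv⇒≡ []       []       e = ≡.refl
        Eqv⇒≡ (y ∷ ys) (z ∷ zs) e = ≡.cong₂ _∷_ (to (Eqv⇔ y z) (e zero)) (Eqv⇒≡ ys zs (e ∘ suc))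

      wellDef : WellDef R (⟦_⟧ R interpretation 𝒜 a)
      wellDef =
        (λ y _ → from (Eqv⇔ y y) ≡.refl) ,
        (λ y z _ _ e → from (Eqv⇔ z y) (≡.sym (to (Eqv⇔ y z) e))) ,
        (λ y z w _ _ _ e f → from (Eqv⇔ y w) (≡.trans (to (Eqv⇔ y z) e) (to (Eqv⇔ z w) f))) ,
        (λ s ys zs _ _ e h → ≡.subst (Rel s) (Eqv⇒≡ ys zs e) h)

      private
        encoding : Encoding R (⟦_⟧ R interpretation 𝒜 a) wellDef
          (λ y z → matrixAt n 𝒜 a (map rowOf y) (map colOf z)) (λ y → vectorAt n 𝒜 a (map rowOf y))
        encoding = record
          { encode-A = λ {y} {z} _ _ r → ⇔-trans
              (sat-rename R 𝒜 (proj₁ (square-def r)) {ρ = get (tup j ⊗ tup d ⊗ tup d) (a , y , z)}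
                (λ { (inj₁ _) → ≡.refl ; (inj₂ (inj₁ _)) → ≡.refl ; (inj₂ (inj₂ _)) → ≡.refl }))
              (proj₂ (proj₂ (square-def r)) n 𝒜 (a , y , z))
          ; encode-b = λ {y} _ r → ⇔-trans
              (sat-rename R 𝒜 (proj₁ (vector-def r)) {ρ = get (tup j ⊗ tup d) (a , y)}
                (λ { (inj₁ _) → ≡.refl ; (inj₂ _) → ≡.refl }))
              (proj₂ (proj₂ (vector-def r)) n 𝒜 (a , y))
          }

        flat : Tup rows (suc n) → Tup cols (suc n) → Vec (Fin (suc n)) d
        flat r c = flatten (rows ⊗ cols) (r , c)

        rowOf-flat : ∀ r c → map rowOf (flat r c) ≡ r
        rowOf-flat r c = ≡.cong proj₁ (unflatten-flatten (rows ⊗ cols) (r , c))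

        colOf-flat : ∀ r c → map colOf (flat r c) ≡ c
        colOf-flat r c = ≡.cong proj₂ (unflatten-flatten (rows ⊗ cols) (r , c))

        row₀ : Tup rows (suc n)
        row₀ = constant rows zero

        col₀ : Tup cols (suc n)
        col₀ = constant cols zero

      interpretation-solves : IInSolve R (⟦_⟧ R interpretation 𝒜 a) ⇔ Solves n 𝒜 a
      interpretation-solves = mk⇔
        (λ h → span-resp (λ r → ≡.cong (vectorAt n 𝒜 a) (rowOf-flat r col₀))
          (span-pull (λ r → flat r col₀ , tt) (λ (z , _) → span-resp
            (λ r → ≡.cong (λ r → matrixAt n 𝒜 a r (map colOf z)) (≡.sym (rowOf-flat r col₀))) (span-gen (map colOf z)))
            (solve⇒span R _ wellDef encoding h)))
        (λ s → span⇒solve R _ wellDef encoding (λ _ → yes tt) (λ y z → decide (proj₁ (proj₂ allFormulas)) 𝒜 _)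
          (span-pull (λ (y , _) → map rowOf y) (λ c → span-resp
            (λ (y , _) → ≡.cong (matrixAt n 𝒜 a (map rowOf y)) (colOf-flat row₀ c)) (span-gen (flat row₀ c , tt))) s))

    reducible : {q : Query σ j} → (∀ n 𝒜 a → q n 𝒜 a ⇔ Solves n 𝒜 a) → ReducibleBy q
    reducible q⇔S = interpretation , allFormulas , wellDef ,
      λ n 𝒜 a → ⇔-trans (q⇔S n 𝒜 a) (⇔-sym (interpretation-solves n 𝒜 a))

  -- One-element universes have too few tuples to be covered by the same system as the others.
  record Normal {j} (q : Query σ j) : Set₁ where
    field
      system      : System j
      solves      : ∀ n 𝒜 a → q (suc n) 𝒜 a ⇔ System.Solves system (suc n) 𝒜 a
      trivial     : Fn (tup 1) Bool
      trivial-def : Definable (tup 1) trivial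
      decides     : ∀ 𝒜 a → q 0 𝒜 a ⇔ (trivial 0 𝒜 (zero ∷ []) ≡ true)

  module _ {j} (S : System j) where
    open System S

    private
      multiple? : ∀ x y → Dec (∃ λ c → y ≡ c * x)
      multiple? x y = Fin.any? (λ c → y Fin.≟ c * x)

      point : Sub (tup 1) (tup j ⊗ rows ⊗ cols)
      point = constantˢ (tup j ⊗ rows ⊗ cols)

      row : Sub (tup 1) (tup j ⊗ rows)
      row = constantˢ (tup j ⊗ rows)

    -- In a one-element universe every index set is a singleton, so the system is one equation in
    -- one unknown and its solvability is looked up in a finite table. The argument supplies a
    -- variable, through which a quantifier-free formula can speak about the only element.
    solvesTrivially : Fn (tup 1) Bool
    solvesTrivially n 𝒜 x = does (multiple? (M n 𝒜 (map point x)) (v n 𝒜 (map row x)))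

    solvesTrivially-def : Definable (tup 1) solvesTrivially
    solvesTrivially-def = def-bind (def-sub point M-def)
      (λ x → def-map Bool._≟_ (λ y → does (multiple? x y)) (def-sub row v-def))

    solvesTrivially-correct : ∀ 𝒜 a → Solves 0 𝒜 a ⇔ (solvesTrivially 0 𝒜 (zero ∷ []) ≡ true)
    solvesTrivially-correct 𝒜 a = ⇔-trans (mk⇔ multiple spanned)
      (mk⇔ (dec-true (multiple? _ _)) (does-true (multiple? _ _)))
      where
      r₀ = constant rows zero
      c₀ = constant cols zero
      a₀ = constant (tup j) zero

      multiple : Solves 0 𝒜 a → ∃ λ c → vectorAt 0 𝒜 a₀ r₀ ≡ c * matrixAt 0 𝒜 a₀ r₀ c₀
      multiple s = ≡.subst (λ a → ∃ λ c → vectorAt 0 𝒜 a r₀ ≡ c * matrixAt 0 𝒜 a r₀ c₀)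
        (constant-unique (tup j) a) (at-row s)
        where
        at-row : ∀ {w} → InSpan (matrixAt 0 𝒜 a) w → ∃ λ c → w r₀ ≡ c * matrixAt 0 𝒜 a r₀ c₀
        at-row (nil w≡0) = 0# , ≡.trans (w≡0 r₀) (sym (zeroˡ _))
        at-row (cons c′ x s e) with at-row s | constant-unique cols c′
        ... | y , f | ≡.refl = x + y , ≡.trans (e r₀) (≡.trans (≡.cong (x * _ +_) f) (sym (distribʳ _ x y)))

      spanned : (∃ λ c → vectorAt 0 𝒜 a₀ r₀ ≡ c * matrixAt 0 𝒜 a₀ r₀ c₀) → Solves 0 𝒜 a
      spanned (c , e) = ≡.subst (Solves 0 𝒜) (≡.sym (constant-unique (tup j) a))
        (cons c₀ c (nil (λ _ → ≡.refl)) at-row)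
        where
        at-row : ∀ r → vectorAt 0 𝒜 a₀ r ≡ c * matrixAt 0 𝒜 a₀ r c₀ + 0#
        at-row r rewrite constant-unique rows r = ≡.trans e (sym (+-identityʳ _))

  reducible⇒normal : ∀ {j} {q : Query σ j} → ReducibleBy q → Normal q
  reducible⇒normal (I , PI , wd , red) = record
    { system      = normalised
    ; solves      = λ n 𝒜 a → ⇔-trans (red (suc n) 𝒜 a) (normalised-solves (suc n) 𝒜 a)
    ; trivial     = solvesTrivially normalised
    ; trivial-def = solvesTrivially-def normalised
    ; decides     = λ 𝒜 a → ⇔-trans (red 0 𝒜 a) (⇔-trans (normalised-solves 0 𝒜 a) (solvesTrivially-correct normalised 𝒜 a))
    }
    where open FromInterpretation I PI wd

  normal⇒reducible : ∀ {j} {q : Query σ j} → Normal q → ReducibleBy q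
  normal⇒reducible {j} {q} N = ToInterpretation.reducible (TaggedSystem.untag tagged) correct
    where
    open Normal N

    -- The row default selects the slack rows and the column default the columns of the system.
    tagged : TaggedSystem j
    tagged = block false true system (slack trivial-def)

    correct₀ : ∀ 𝒜 a → (trivial 0 𝒜 (zero ∷ []) ≡ true) ⇔ System.Solves (TaggedSystem.untag tagged) 0 𝒜 a
    correct₀ 𝒜 a = mk⇔
      (λ θ → nil (λ (w , r , b) → ≡.trans (TaggedSystem.untag-trivial-v tagged 𝒜 a w (r , b))
        (≡.trans (≡.cong (λ b → slack-v (trivial 0 𝒜 b)) (constant-unique (tup 1) b)) (≡.cong slack-v θ))))
      (λ s → reads _ (≡.trans (≡.sym (TaggedSystem.untag-trivial-v tagged 𝒜 a w₀ (r₀ , zero ∷ [])))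
        (span-zero-row (w₀ , r₀ , zero ∷ []) (λ (w , c) → TaggedSystem.untag-trivial-M tagged 𝒜 a w₀ w (r₀ , zero ∷ []) c) s)))
      where
      r₀ = constant (System.rows system) zero
      w₀ = replicate (TaggedSystem.rowDigits tagged) zero

      slack-v : Bool → Carrier R
      slack-v θ = if θ then 0# else socle

      reads : ∀ θ → slack-v θ ≡ 0# → θ ≡ true
      reads true  e = ≡.refl
      reads false e = contradiction e socle≢0

    correct : ∀ n 𝒜 a → q n 𝒜 a ⇔ System.Solves (TaggedSystem.untag tagged) n 𝒜 a
    correct zero 𝒜 a = ⇔-trans (decides 𝒜 a) (correct₀ 𝒜 a)
    correct (suc n) 𝒜 a = ⇔-trans (solves n 𝒜 a) (⇔-trans
      (mk⇔ (λ s → from (block-solves false true system (slack trivial-def) (suc n) 𝒜 a)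
             (s , slack-solves trivial-def (suc n) 𝒜 a))
           (proj₁ ∘ to (block-solves false true system (slack trivial-def) (suc n) 𝒜 a)))
      (⇔-sym (TaggedSystem.untag-solves tagged n 𝒜 a)))

  normal-not : ∀ {j} {q : Query σ j} → Normal q → Normal (qNot {σ} {j} q)
  normal-not N = record
    { system      = TaggedSystem.untag (dualSystem system)
    ; solves      = λ n 𝒜 a → ⇔-trans (¬-⇔ R (solves n 𝒜 a))
        (⇔-trans (⇔-sym (dual-solves system (suc n) 𝒜 a)) (⇔-sym (TaggedSystem.untag-solves (dualSystem system) n 𝒜 a)))
    ; trivial     = λ n 𝒜 x → if trivial n 𝒜 x then false else true
    ; trivial-def = def-if trivial-def (def-const Bool._≟_ false) (def-const Bool._≟_ true)
    ; decides     = λ 𝒜 a → ⇔-trans (¬-⇔ R (decides 𝒜 a)) (negated _)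
    }
    where
    open Normal N

    negated : ∀ b → (¬ b ≡ true) ⇔ ((if b then false else true) ≡ true)
    negated true  = mk⇔ (λ n → contradiction ≡.refl n) (λ ())
    negated false = mk⇔ (λ _ → ≡.refl) (λ _ ())

  normal-and : ∀ {j} {q₁ q₂ : Query σ j} → Normal q₁ → Normal q₂ → Normal (qAnd {σ} {j} q₁ q₂)
  normal-and N₁ N₂ = record
    { system      = TaggedSystem.untag (block true true N₁.system N₂.system)
    ; solves      = λ n 𝒜 a → ⇔-trans (×-⇔ R (N₁.solves n 𝒜 a) (N₂.solves n 𝒜 a))
        (⇔-trans (⇔-sym (block-solves true true N₁.system N₂.system (suc n) 𝒜 a))
                 (⇔-sym (TaggedSystem.untag-solves (block true true N₁.system N₂.system) n 𝒜 a)))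
    ; trivial     = λ n 𝒜 x → if N₁.trivial n 𝒜 x then N₂.trivial n 𝒜 x else false
    ; trivial-def = def-if N₁.trivial-def N₂.trivial-def (def-const Bool._≟_ false)
    ; decides     = λ 𝒜 a → ⇔-trans (×-⇔ R (N₁.decides 𝒜 a) (N₂.decides 𝒜 a)) (conjoined _)
    }
    where
    module N₁ = Normal N₁
    module N₂ = Normal N₂

    conjoined : ∀ b {b′} → (b ≡ true × b′ ≡ true) ⇔ ((if b then b′ else false) ≡ true)
    conjoined true  = mk⇔ proj₂ (λ e → ≡.refl , e)
    conjoined false = mk⇔ (λ ()) (λ ())

  normal-all : ∀ {j} {q : Query σ (suc j)} → Normal q → Normal (qAll {σ} {j} q)
  normal-all N = record
    { system      = forallSystem system
    ; solves      = λ n 𝒜 a → ⇔-trans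
        (mk⇔ (λ h b → to (solves n 𝒜 (b ∷ a)) (h b)) (λ h b → from (solves n 𝒜 (b ∷ a)) (h b)))
        (⇔-sym (forall-solves system (suc n) 𝒜 a))
    ; trivial     = trivial
    ; trivial-def = trivial-def
    -- With a single element to range over, the quantified query has the same truth value as its
    -- instance, so the sentence is kept.
    ; decides     = λ 𝒜 a → mk⇔ (λ h → to (decides 𝒜 (zero ∷ a)) (h zero)) (λ { e zero → from (decides 𝒜 (zero ∷ a)) e })
    }
    where open Normal N

  normal-decidable : ∀ {j} {q : Query σ j} → Normal q → ∀ n 𝒜 a → Dec (q n 𝒜 a)
  normal-decidable N zero    𝒜 a = dec-map (⇔-sym (Normal.decides N 𝒜 a)) (_ Bool.≟ true)
  normal-decidable N (suc n) 𝒜 a = dec-map (⇔-sym (Normal.solves N n 𝒜 a)) (solves? (Normal.system N) (suc n) 𝒜 a)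

  normal-resp : ∀ {j} {q q′ : Query σ j} → (∀ n 𝒜 a → q n 𝒜 a ⇔ q′ n 𝒜 a) → Normal q → Normal q′
  normal-resp q⇔q′ N = record
    { system = system ; trivial = trivial ; trivial-def = trivial-def
    ; solves  = λ n 𝒜 a → ⇔-trans (⇔-sym (q⇔q′ (suc n) 𝒜 a)) (solves n 𝒜 a)
    ; decides = λ 𝒜 a → ⇔-trans (⇔-sym (q⇔q′ 0 𝒜 a)) (decides 𝒜 a)
    }
    where open Normal N

  normal-ex : ∀ {j} {q : Query σ (suc j)} → Normal q → Normal (qEx {σ} {j} q)
  normal-ex {q = q} N = normal-resp
    (λ n 𝒜 a → mk⇔
      (λ ¬all → let b , ¬¬h = Fin.¬∀⟶∃¬ (suc n) _ (λ b → ¬? (normal-decidable N n 𝒜 (b ∷ a))) ¬all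
                in b , decidable-stable (normal-decidable N n 𝒜 (b ∷ a)) ¬¬h)
      (λ (b , h) all → all b h))
    (normal-not (normal-all (normal-not N)))

-- Closure of the classes

module _ {n n′ : ℕ} (f : Fin n ↔ Fin n′) where
  private
    module f = Inverse f

  map-from-to : ∀ {j} (a : Vec (Fin n) j) → Vec.map f.from (Vec.map f.to a) ≡ a
  map-from-to a = ≡.trans (≡.sym (Vec.map-∘ f.from f.to a)) (≡.trans (Vec.map-cong f.strictlyInverseʳ a) (Vec.map-id a))

  map-to-from : ∀ {j} (a : Vec (Fin n′) j) → Vec.map f.to (Vec.map f.from a) ≡ a
  map-to-from a = ≡.trans (≡.sym (Vec.map-∘ f.to f.from a)) (≡.trans (Vec.map-cong f.strictlyInverseˡ a) (Vec.map-id a))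

  iso-sym : ∀ {σ} {𝒜 : Struct σ n} {𝔅 : Struct σ n′} → Iso {σ} 𝒜 𝔅 f → Iso {σ} 𝔅 𝒜 (↔-sym f)
  iso-sym {𝔅 = 𝔅} i s t = ≡.sym (≡.trans (i s (Vec.map f.from t)) (≡.cong (𝔅 s) (map-to-from t)))

module _ {σ : Signature} where

  -- Closure is stated in one direction only, so a counterexample is carried back along the inverse
  -- isomorphism.
  isoClosed-not : ∀ {j} {q : Query σ j} → IsoClosed {σ} {j} q → IsoClosed {σ} {j} (qNot {σ} {j} q)
  isoClosed-not {q = q} c n n′ 𝒜 𝔅 f i a ¬h h = ¬h (≡.subst (q n 𝒜) (map-from-to f a)
    (c n′ n 𝔅 𝒜 (↔-sym f) (iso-sym f {σ} {𝒜} {𝔅} i) (Vec.map (Inverse.to f) a) h))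

  isoClosed-and : ∀ {j} {q₁ q₂ : Query σ j} → IsoClosed {σ} {j} q₁ → IsoClosed {σ} {j} q₂ →
    IsoClosed {σ} {j} (qAnd {σ} {j} q₁ q₂)
  isoClosed-and c₁ c₂ n n′ 𝒜 𝔅 f i a = Prod.map (c₁ n n′ 𝒜 𝔅 f i a) (c₂ n n′ 𝒜 𝔅 f i a)

  isoClosed-all : ∀ {j} {q : Query σ (suc j)} → IsoClosed {σ} {suc j} q → IsoClosed {σ} {j} (qAll {σ} {j} q)
  isoClosed-all {q = q} c n n′ 𝒜 𝔅 f i a h b =
    ≡.subst (λ b → q n′ 𝔅 (b ∷ Vec.map (Inverse.to f) a)) (Inverse.strictlyInverseˡ f b)
      (c n n′ 𝒜 𝔅 f i (Inverse.from f b ∷ a) (h (Inverse.from f b)))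

  isoClosed-ex : ∀ {j} {q : Query σ (suc j)} → IsoClosed {σ} {suc j} q → IsoClosed {σ} {j} (qEx {σ} {j} q)
  isoClosed-ex c n n′ 𝒜 𝔅 f i a (b , h) = Inverse.to f b , c n n′ 𝒜 𝔅 f i (b ∷ a) h

  ClosedUnderFO : (∀ {j} → Query σ j → Set₁) → Set₁
  ClosedUnderFO C =
    (∀ j (q : Query σ j) → C {j} q → C {j} (qNot {σ} {j} q)) ×
    (∀ j (q₁ q₂ : Query σ j) → C {j} q₁ → C {j} q₂ → C {j} (qAnd {σ} {j} q₁ q₂)) ×
    (∀ j (q : Query σ (suc j)) → C {suc j} q → C {j} (qAll {σ} {j} q) × C {j} (qEx {σ} {j} q))

  closed-with-iso : ∀ (C : ∀ {j} → Query σ j → Set₁) → ClosedUnderFO C →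
    ClosedUnderFO (λ {j} q → IsoClosed {σ} {j} q × C {j} q)
  closed-with-iso C (complement , meet , quantify) =
    (λ j q (i , h) → isoClosed-not {j} {q} i , complement j q h) ,
    (λ j q₁ q₂ (i₁ , h₁) (i₂ , h₂) → isoClosed-and {j} {q₁} {q₂} i₁ i₂ , meet j q₁ q₂ h₁ h₂) ,
    (λ j q (i , h) → (isoClosed-all {j} {q} i , proj₁ (quantify j q h)) , (isoClosed-ex {j} {q} i , proj₂ (quantify j q h)))

  -- The logic contains these operations as formula constructors. Only the quantified variable has
  -- to be moved, from position zero of the tuple to `nothing`.
  turing-closed : ∀ R → ClosedUnderFO (λ {j} q → Reducible R turingRed {σ} {j} q)
  turing-closed R =
    (λ j q (ψ , e) → neg ψ , λ n 𝒜 a → ¬-⇔ R (e n 𝒜 a)) ,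
    (λ j q₁ q₂ (ψ₁ , e₁) (ψ₂ , e₂) → and ψ₁ ψ₂ , λ n 𝒜 a → ×-⇔ R (e₁ n 𝒜 a) (e₂ n 𝒜 a)) ,
    (λ j q (ψ , e) →
      (all (rename R bind ψ) , λ n 𝒜 a → mk⇔
        (λ h b → to (body ψ e n 𝒜 a b) (h b)) (λ h b → from (body ψ e n 𝒜 a b) (h b))) ,
      (ex (rename R bind ψ) , λ n 𝒜 a → mk⇔
        (λ (b , h) → b , to (body ψ e n 𝒜 a b) h) (λ (b , h) → b , from (body ψ e n 𝒜 a b) h)))
    where
    bind : ∀ {j} → Fin (suc j) → Maybe (Fin j)
    bind zero    = nothing
    bind (suc i) = just i

    body : ∀ {j} {q : Query σ (suc j)} (ψ : Formula R σ (Fin (suc j))) →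
      (∀ n (𝒜 : Struct σ (suc n)) a → q n 𝒜 a ⇔ Sat R 𝒜 ψ (lookup a)) →
      ∀ n (𝒜 : Struct σ (suc n)) a b → q n 𝒜 (b ∷ a) ⇔ Sat R 𝒜 (rename R bind ψ) (maybe′ (lookup a) b)
    body ψ e n 𝒜 a b = ⇔-trans (e n 𝒜 (b ∷ a))
      (⇔-sym (sat-rename R 𝒜 ψ {ρ = lookup (b ∷ a)} (λ { zero → ≡.refl ; (suc i) → ≡.refl })))

  fragment-closed : ∀ R {p} k → Prime p → IsCharacteristic R (p ^ suc k) → (𝓛 : Fragment R σ) →
    ClosedUnderFO (λ {j} q → Σ (Interp R σ j) λ I → AllFormulas R (Fragment.P 𝓛) I × ReducesVia R I q)
  fragment-closed R k pr char 𝓛 =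
    (λ j q h → normal⇒reducible {j} (normal-not {j} {q} (reducible⇒normal {j} {q} h))) ,
    (λ j q₁ q₂ h₁ h₂ → normal⇒reducible {j}
      (normal-and {j} {q₁} {q₂} (reducible⇒normal {j} {q₁} h₁) (reducible⇒normal {j} {q₂} h₂))) ,
    (λ j q h →
      normal⇒reducible {j} (normal-all {j} {q} (reducible⇒normal {suc j} {q} h)) ,
      normal⇒reducible {j} (normal-ex {j} {q} (reducible⇒normal {suc j} {q} h)))
    where open Closure R k pr char 𝓛

theorem4p5 : (R : FinCommRing) → PrimePowerChar R →
    (k : RedKind) (σ : Signature) →
    (∀ j (q : Query σ j) → InClass R k σ j q → InClass R k σ j (qNot {σ} {j} q)) ×
    (∀ j (q₁ q₂ : Query σ j) → InClass R k σ j q₁ → InClass R k σ j q₂ → InClass R k σ j (qAnd {σ} {j} q₁ q₂)) ×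
    (∀ j (q : Query σ (suc j)) → InClass R k σ (suc j) q → InClass R k σ j (qAll {σ} {j} q) × InClass R k σ j (qEx {σ} {j} q))
-- As the exponent is at least one, it is a successor, and pᵏ is here the last power of p that is
-- nonzero in R.
theorem4p5 R (p , suc k , pr , _ , char) qfRed     σ =
  closed-with-iso {σ} (λ {j} q → Reducible R qfRed {σ} {j} q) (fragment-closed R k pr char (quantifierFree R σ))
theorem4p5 R (p , suc k , pr , _ , char) foRed     σ =
  closed-with-iso {σ} (λ {j} q → Reducible R foRed {σ} {j} q) (fragment-closed R k pr char (firstOrder R σ))
theorem4p5 R _                           turingRed σ =
  closed-with-iso {σ} (λ {j} q → Reducible R turingRed {σ} {j} q) (turing-closed R)
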